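{- Let $\mathcal M_{2n}$ be the set of all perfect matchings of the complete graph $K_{2n}$. A function $f\colon\mathcal M_{2n}\to\{0,1\}$ has degree at most $1$ if and only if it is one of the following: a constant function; a function depending only on which vertex is matched to $i$, for some vertex $i$; or a function depending only on whether the perfect matching contains an edge of $\{\{i,j\},\{j,k\},\{k,i\}\}$, for some triangle given by three distinct vertices $i,j,k$.
   Context: For an edge $\{i,j\}$ of $K_{2n}$ and a perfect matching $m\in\mathcal M_{2n}$, let $x_{i,j}(m)=1$ if $\{i,j\}\in m$ and $x_{i,j}(m)=0$ otherwise. A function $f\colon\mathcal M_{2n}\to\mathbb R$ has degree at most $d$ if it can be written as a polynomial of degree at most $d$ in the variables $x_{i,j}$; in particular, $f$ has degree at most $1$ if it is a real linear combination of the constant function $1$ and the functions $x_{i,j}$. -}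

module Defs where

open import Algebra.Bundles using (CommutativeRing; CommutativeMonoid)
import Algebra.Properties.CommutativeSemigroup as CommutativeSemigroupProperties
import Algebra.Properties.Group as GroupProperties
open import Data.Bool.Base using (Bool; true; false; _∨_; if_then_else_)
open import Data.Fin.Base using (Fin) renaming (_<_ to _<ᶠ_)
open import Data.List.Base using (List; []; _∷_; length)
open import Data.List.Relation.Unary.All using (All)
open import Data.Nat.Base using (ℕ; _⊔_) renaming (_≤_ to _≤ⁿ_)
import Data.Nat.Properties as ℕ
open import Data.Product using (_×_; _,_; ∃; ∃-syntax; ∃!; proj₁; proj₂)
open import Data.Rational.Base
  using (ℚ; 0ℚ; 1ℚ; ½; _+_; _*_; _-_; -_; ∣_∣; _<_; 1/_; positive)
import Data.Rational.Properties as ℚ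
open import Function.Bundles using (Func; _⟶ₛ_)
open import Level using (0ℓ)
open import Relation.Binary.Bundles using (Setoid)
open import Relation.Binary.PropositionalEquality
  using (_≡_; _≢_; _≗_; refl; sym; trans; cong; cong₂; subst; setoid)

-- The real numbers are Cauchy sequences of rationals, equal when their
-- difference tends to 0.

Cauchy : (ℕ → ℚ) → Set
Cauchy s = ∀ ε → 0ℚ < ε → ∃[ N ] (∀ m n → N ≤ⁿ m → N ≤ⁿ n → ∣ s m - s n ∣ < ε)

record ℝ : Set where
  constructor mkℝ
  field
    seq    : ℕ → ℚ
    cauchy : Cauchy seq

open ℝ public

infix 4 _≈ᵣ_

_≈ᵣ_ : ℝ → ℝ → Set
x ≈ᵣ y = ∀ ε → 0ℚ < ε → ∃[ N ] (∀ n → N ≤ⁿ n → ∣ seq x n - seq y n ∣ < ε)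

private
  open GroupProperties ℚ.+-0-group using (⁻¹-anti-homo-//; //-rightDividesˡ)
  open CommutativeSemigroupProperties
    (CommutativeMonoid.commutativeSemigroup ℚ.+-0-commutativeMonoid)
    using (interchange)
  open ℚ.≤-Reasoning

  split : ∀ p q r → p - r ≡ (p - q) + (q - r)
  split p q r = begin-equality
    p - r                ≡⟨ cong (_- r) (//-rightDividesˡ q p) ⟨
    (p - q) + q - r      ≡⟨ ℚ.+-assoc (p - q) q (- r) ⟩
    (p - q) + (q - r)    ∎

  *-distrib-- : ∀ p q r → p * (q - r) ≡ p * q - p * r
  *-distrib-- p q r = trans (ℚ.*-distribˡ-+ p q (- r))
    (cong (p * q +_) (sym (ℚ.neg-distribʳ-* p r)))

  half : ∀ ε → 0ℚ < ε → 0ℚ < ε * ½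
  half ε 0<ε = begin-strict
    0ℚ      ≡⟨ ℚ.*-zeroˡ ½ ⟨
    0ℚ * ½  <⟨ ℚ.*-monoˡ-<-pos ½ 0<ε ⟩
    ε * ½   ∎

  half+half : ∀ ε → ε * ½ + ε * ½ ≡ ε
  half+half ε = trans (sym (ℚ.*-distribˡ-+ ε ½ ½)) (ℚ.*-identityʳ ε)

  ∣p-p∣≡0 : ∀ p → ∣ p - p ∣ ≡ 0ℚ
  ∣p-p∣≡0 p = cong ∣_∣ (ℚ.+-inverseʳ p)

  ∣p-q∣≡∣q-p∣ : ∀ p q → ∣ p - q ∣ ≡ ∣ q - p ∣
  ∣p-q∣≡∣q-p∣ p q = trans
    (cong ∣_∣ (sym (⁻¹-anti-homo-// q p)))
    (ℚ.∣-p∣≡∣p∣ (q - p))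

  triangle : ∀ {p q r ε} → p ≡ q + r → ∣ q ∣ < ε * ½ → ∣ r ∣ < ε * ½ → ∣ p ∣ < ε
  triangle {p} {q} {r} {ε} p≡ q< r< = begin-strict
    ∣ p ∣          ≡⟨ cong ∣_∣ p≡ ⟩
    ∣ q + r ∣      ≤⟨ ℚ.∣p+q∣≤∣p∣+∣q∣ q r ⟩
    ∣ q ∣ + ∣ r ∣  <⟨ ℚ.+-mono-< q< r< ⟩
    ε * ½ + ε * ½  ≡⟨ half+half ε ⟩
    ε              ∎

  +-close : ∀ p p′ q q′ {ε} → ∣ p - p′ ∣ < ε * ½ → ∣ q - q′ ∣ < ε * ½ →
            ∣ (p + q) - (p′ + q′) ∣ < ε
  +-close p p′ q q′ = triangle
    (trans (cong (p + q +_) (ℚ.neg-distrib-+ p′ q′))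
           (interchange p q (- p′) (- q′)))

  neg-close : ∀ p q {ε} → ∣ p - q ∣ < ε → ∣ - p - - q ∣ < ε
  neg-close p q {ε} = subst (_< ε)
    (trans (sym (ℚ.∣-p∣≡∣p∣ (p - q))) (cong ∣_∣ (ℚ.neg-distrib-+ p (- q))))

  ∣p*q∣< : ∀ {p q B δ} → 0ℚ < B → ∣ p ∣ < B → ∣ q ∣ < δ → ∣ p * q ∣ < B * δ
  ∣p*q∣< {p} {q} {B} {δ} 0<B p<B q<δ = begin-strict
    ∣ p * q ∣      ≡⟨ ℚ.∣p*q∣≡∣p∣*∣q∣ p q ⟩
    ∣ p ∣ * ∣ q ∣  ≤⟨ ℚ.*-monoʳ-≤-nonNeg ∣ q ∣ {{ℚ.∣-∣-nonNeg q}} (ℚ.<⇒≤ p<B) ⟩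
    B * ∣ q ∣      <⟨ ℚ.*-monoʳ-<-pos B {{positive 0<B}} q<δ ⟩
    B * δ          ∎

  record Scale (B ε : ℚ) : Set where
    field
      δ    : ℚ
      0<δ  : 0ℚ < δ
      Bδ≡ε : B * δ ≡ ε

  scale : ∀ B ε → 0ℚ < B → 0ℚ < ε → Scale B ε
  scale B ε 0<B 0<ε = record
    { δ    = B⁻¹ * ε
    ; 0<δ  = begin-strict
        0ℚ        ≡⟨ ℚ.*-zeroʳ B⁻¹ ⟨
        B⁻¹ * 0ℚ  <⟨ ℚ.*-monoʳ-<-pos B⁻¹ {{ℚ.1/pos⇒pos B {{pos}}}} 0<ε ⟩
        B⁻¹ * ε   ∎
    ; Bδ≡ε = begin-equality
        B * (B⁻¹ * ε)  ≡⟨ ℚ.*-assoc B B⁻¹ ε ⟨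
        B * B⁻¹ * ε    ≡⟨ cong (_* ε) (ℚ.*-inverseʳ B {{nz}}) ⟩
        1ℚ * ε         ≡⟨ ℚ.*-identityˡ ε ⟩
        ε              ∎
    }
    where
    pos = positive 0<B
    nz  = ℚ.pos⇒nonZero B {{pos}}
    B⁻¹ = (1/ B) {{nz}}

  *-close : ∀ {p p′ q q′ B δ ε} → 0ℚ < B → B * δ ≡ ε * ½ →
            ∣ p ∣ < B → ∣ q′ ∣ < B → ∣ p - p′ ∣ < δ → ∣ q - q′ ∣ < δ →
            ∣ p * q - p′ * q′ ∣ < ε
  *-close {p} {p′} {q} {q′} 0<B Bδ≡ p<B q′<B p-p′<δ q-q′<δ = triangle
    (trans (split (p * q) (p * q′) (p′ * q′)) (cong₂ _+_
      (sym (*-distrib-- p q q′))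
      (trans (cong₂ _-_ (ℚ.*-comm p q′) (ℚ.*-comm p′ q′))
             (sym (*-distrib-- q′ p p′)))))
    (subst (_ <_) Bδ≡ (∣p*q∣< 0<B p<B q-q′<δ))
    (subst (_ <_) Bδ≡ (∣p*q∣< 0<B q′<B p-p′<δ))

  record Bound (x y : ℝ) : Set where
    field
      B    : ℚ
      0<B  : 0ℚ < B
      from : ℕ
      x<B  : ∀ n → from ≤ⁿ n → ∣ seq x n ∣ < B
      y<B  : ∀ n → from ≤ⁿ n → ∣ seq y n ∣ < B

  bound₁ : ∀ x → ∃[ B ] 0ℚ < B × ∃[ N ] (∀ n → N ≤ⁿ n → ∣ seq x n ∣ < B)
  bound₁ x with N , close ← cauchy x 1ℚ (ℚ.positive⁻¹ 1ℚ) =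
    b + 1ℚ , 0<b+1 , N , λ n N≤n → begin-strict
      ∣ seq x n ∣                        ≡⟨ cong ∣_∣ (trans
                                              (ℚ.+-comm (seq x N) (seq x n - seq x N))
                                              (//-rightDividesˡ (seq x N) (seq x n))) ⟨
      ∣ seq x N + (seq x n - seq x N) ∣  ≤⟨ ℚ.∣p+q∣≤∣p∣+∣q∣ (seq x N) (seq x n - seq x N) ⟩
      b + ∣ seq x n - seq x N ∣          <⟨ ℚ.+-monoʳ-< b (close n N N≤n ℕ.≤-refl) ⟩
      b + 1ℚ                             ∎
    where
    b = ∣ seq x N ∣
    0<b+1 : 0ℚ < b + 1ℚ
    0<b+1 = ℚ.+-mono-≤-< (ℚ.0≤∣p∣ (seq x N)) (ℚ.positive⁻¹ 1ℚ)

  bound : ∀ x y → Bound x y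
  bound x y
    with A , 0<A , M , x<A ← bound₁ x | C , 0<C , N , y<C ← bound₁ y = record
    { B    = A + C
    ; 0<B  = ℚ.+-mono-< 0<A 0<C
    ; from = M ⊔ N
    ; x<B  = λ n MN≤n → ℚ.<-trans (x<A n (ℕ.m⊔n≤o⇒m≤o M N MN≤n))
               (subst (_< A + C) (ℚ.+-identityʳ A) (ℚ.+-monoʳ-< A 0<C))
    ; y<B  = λ n MN≤n → ℚ.<-trans (y<C n (ℕ.m⊔n≤o⇒n≤o M N MN≤n))
               (subst (_< A + C) (ℚ.+-identityˡ C) (ℚ.+-monoˡ-< C 0<A))
    }

infix  8 -ᵣ_
infixl 7 _*ᵣ_
infixl 6 _+ᵣ_

fromℚ : ℚ → ℝ
fromℚ q = mkℝ (λ _ → q) λ ε 0<ε →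
  0 , λ _ _ _ _ → subst (_< ε) (sym (∣p-p∣≡0 q)) 0<ε

0ᵣ 1ᵣ : ℝ
0ᵣ = fromℚ 0ℚ
1ᵣ = fromℚ 1ℚ

_+ᵣ_ : ℝ → ℝ → ℝ
x +ᵣ y = mkℝ (λ n → seq x n + seq y n) c
  where
  c : Cauchy (λ n → seq x n + seq y n)
  c ε 0<ε with M , x-close ← cauchy x (ε * ½) (half ε 0<ε)
             | N , y-close ← cauchy y (ε * ½) (half ε 0<ε) =
    M ⊔ N , λ m n ≤m ≤n → +-close (seq x m) (seq x n) (seq y m) (seq y n)
      (x-close m n (ℕ.m⊔n≤o⇒m≤o M N ≤m) (ℕ.m⊔n≤o⇒m≤o M N ≤n))
      (y-close m n (ℕ.m⊔n≤o⇒n≤o M N ≤m) (ℕ.m⊔n≤o⇒n≤o M N ≤n))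

-ᵣ_ : ℝ → ℝ
-ᵣ x = mkℝ (λ n → - seq x n) λ ε 0<ε → let N , close = cauchy x ε 0<ε in
  N , λ m n ≤m ≤n → neg-close (seq x m) (seq x n) (close m n ≤m ≤n)

_*ᵣ_ : ℝ → ℝ → ℝ
x *ᵣ y = mkℝ (λ n → seq x n * seq y n) c
  where
  open Bound (bound x y)
  c : Cauchy (λ n → seq x n * seq y n)
  c ε 0<ε = K ⊔ from , λ m n ≤m ≤n → *-close 0<B Bδ≡ε
    (x<B m (ℕ.m⊔n≤o⇒n≤o K from ≤m))
    (y<B n (ℕ.m⊔n≤o⇒n≤o K from ≤n))
    (proj₂ x-close m n (M≤ ≤m) (M≤ ≤n))
    (proj₂ y-close m n (N≤ ≤m) (N≤ ≤n))
    where
    open Scale (scale B (ε * ½) 0<B (half ε 0<ε))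
    x-close = cauchy x δ 0<δ
    y-close = cauchy y δ 0<δ
    M = proj₁ x-close
    N = proj₁ y-close
    K = M ⊔ N
    M≤ : ∀ {k} → K ⊔ from ≤ⁿ k → M ≤ⁿ k
    M≤ p = ℕ.m⊔n≤o⇒m≤o M N (ℕ.m⊔n≤o⇒m≤o K from p)
    N≤ : ∀ {k} → K ⊔ from ≤ⁿ k → N ≤ⁿ k
    N≤ p = ℕ.m⊔n≤o⇒n≤o M N (ℕ.m⊔n≤o⇒m≤o K from p)

≗⇒≈ᵣ : ∀ {x y} → seq x ≗ seq y → x ≈ᵣ y
≗⇒≈ᵣ {x} {y} x≗y ε 0<ε = 0 , λ n _ → subst (_< ε)
  (sym (trans (cong (λ p → ∣ p - seq y n ∣) (x≗y n)) (∣p-p∣≡0 (seq y n)))) 0<ε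

≈ᵣ-sym : ∀ {x y} → x ≈ᵣ y → y ≈ᵣ x
≈ᵣ-sym {x} {y} x≈y ε 0<ε = let N , close = x≈y ε 0<ε in
  N , λ n N≤n → subst (_< ε) (∣p-q∣≡∣q-p∣ (seq x n) (seq y n)) (close n N≤n)

≈ᵣ-trans : ∀ {x y z} → x ≈ᵣ y → y ≈ᵣ z → x ≈ᵣ z
≈ᵣ-trans {x} {y} {z} x≈y y≈z ε 0<ε
  with M , xy ← x≈y (ε * ½) (half ε 0<ε) | N , yz ← y≈z (ε * ½) (half ε 0<ε) =
  M ⊔ N , λ n ≤n → triangle
    (split (seq x n) (seq y n) (seq z n))
    (xy n (ℕ.m⊔n≤o⇒m≤o M N ≤n)) (yz n (ℕ.m⊔n≤o⇒n≤o M N ≤n))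

+ᵣ-cong : ∀ {x x′ y y′} → x ≈ᵣ x′ → y ≈ᵣ y′ → x +ᵣ y ≈ᵣ x′ +ᵣ y′
+ᵣ-cong {x} {x′} {y} {y′} x≈ y≈ ε 0<ε
  with M , xx ← x≈ (ε * ½) (half ε 0<ε) | N , yy ← y≈ (ε * ½) (half ε 0<ε) =
  M ⊔ N , λ n ≤n → +-close (seq x n) (seq x′ n) (seq y n) (seq y′ n)
    (xx n (ℕ.m⊔n≤o⇒m≤o M N ≤n)) (yy n (ℕ.m⊔n≤o⇒n≤o M N ≤n))

-ᵣ-cong : ∀ {x y} → x ≈ᵣ y → -ᵣ x ≈ᵣ -ᵣ y
-ᵣ-cong {x} {y} x≈y ε 0<ε = let N , close = x≈y ε 0<ε in
  N , λ n N≤n → neg-close (seq x n) (seq y n) (close n N≤n)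

*ᵣ-cong : ∀ {x x′ y y′} → x ≈ᵣ x′ → y ≈ᵣ y′ → x *ᵣ y ≈ᵣ x′ *ᵣ y′
*ᵣ-cong {x} {x′} {y} {y′} x≈ y≈ ε 0<ε = K ⊔ from , λ n ≤n → *-close 0<B Bδ≡ε
    (x<B n (ℕ.m⊔n≤o⇒n≤o K from ≤n))
    (y<B n (ℕ.m⊔n≤o⇒n≤o K from ≤n))
    (proj₂ x-close n (ℕ.m⊔n≤o⇒m≤o M N (ℕ.m⊔n≤o⇒m≤o K from ≤n)))
    (proj₂ y-close n (ℕ.m⊔n≤o⇒n≤o M N (ℕ.m⊔n≤o⇒m≤o K from ≤n)))
  where
  open Bound (bound x y′)
  open Scale (scale B (ε * ½) 0<B (half ε 0<ε))
  x-close = x≈ δ 0<δ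
  y-close = y≈ δ 0<δ
  M = proj₁ x-close
  N = proj₁ y-close
  K = M ⊔ N

ℝ-commutativeRing : CommutativeRing 0ℓ 0ℓ
ℝ-commutativeRing = record
  { Carrier = ℝ
  ; _≈_ = _≈ᵣ_
  ; _+_ = _+ᵣ_
  ; _*_ = _*ᵣ_
  ; -_  = -ᵣ_
  ; 0#  = 0ᵣ
  ; 1#  = 1ᵣ
  ; isCommutativeRing = record
    { isRing = record
      { +-isAbelianGroup = record
        { isGroup = record
          { isMonoid = record
            { isSemigroup = record
              { isMagma = record
                { isEquivalence = record
                  { refl  = λ {x} → ≗⇒≈ᵣ {x} {x} λ _ → refl
                  ; sym   = λ {x} {y} → ≈ᵣ-sym {x} {y}
                  ; trans = λ {x} {y} {z} → ≈ᵣ-trans {x} {y} {z}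
                  }
                ; ∙-cong = λ {x} {x′} {y} {y′} → +ᵣ-cong {x} {x′} {y} {y′}
                }
              ; assoc = λ x y z → ≗⇒≈ᵣ {(x +ᵣ y) +ᵣ z} {x +ᵣ (y +ᵣ z)}
                  λ n → ℚ.+-assoc (seq x n) (seq y n) (seq z n)
              }
            ; identity =
                (λ x → ≗⇒≈ᵣ {0ᵣ +ᵣ x} {x} λ n → ℚ.+-identityˡ (seq x n)) ,
                (λ x → ≗⇒≈ᵣ {x +ᵣ 0ᵣ} {x} λ n → ℚ.+-identityʳ (seq x n))
            }
          ; inverse =
              (λ x → ≗⇒≈ᵣ {(-ᵣ x) +ᵣ x} {0ᵣ} λ n → ℚ.+-inverseˡ (seq x n)) ,
              (λ x → ≗⇒≈ᵣ {x +ᵣ (-ᵣ x)} {0ᵣ} λ n → ℚ.+-inverseʳ (seq x n))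
          ; ⁻¹-cong = λ {x} {y} → -ᵣ-cong {x} {y}
          }
        ; comm = λ x y → ≗⇒≈ᵣ {x +ᵣ y} {y +ᵣ x}
            λ n → ℚ.+-comm (seq x n) (seq y n)
        }
      ; *-cong = λ {x} {x′} {y} {y′} → *ᵣ-cong {x} {x′} {y} {y′}
      ; *-assoc = λ x y z → ≗⇒≈ᵣ {(x *ᵣ y) *ᵣ z} {x *ᵣ (y *ᵣ z)}
          λ n → ℚ.*-assoc (seq x n) (seq y n) (seq z n)
      ; *-identity =
          (λ x → ≗⇒≈ᵣ {1ᵣ *ᵣ x} {x} λ n → ℚ.*-identityˡ (seq x n)) ,
          (λ x → ≗⇒≈ᵣ {x *ᵣ 1ᵣ} {x} λ n → ℚ.*-identityʳ (seq x n))
      ; distrib =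
          (λ x y z → ≗⇒≈ᵣ {x *ᵣ (y +ᵣ z)} {x *ᵣ y +ᵣ x *ᵣ z}
            λ n → ℚ.*-distribˡ-+ (seq x n) (seq y n) (seq z n)) ,
          (λ x y z → ≗⇒≈ᵣ {(y +ᵣ z) *ᵣ x} {y *ᵣ x +ᵣ z *ᵣ x}
            λ n → ℚ.*-distribʳ-+ (seq x n) (seq y n) (seq z n))
      }
    ; *-comm = λ x y → ≗⇒≈ᵣ {x *ᵣ y} {y *ᵣ x}
        λ n → ℚ.*-comm (seq x n) (seq y n)
    }
  }

-- A set of edges of the complete graph is given by its characteristic
-- function on pairs of vertices of K_N, which must be symmetric and vanish on the
-- diagonal.  It is a perfect matching when every vertex lies on exactly one
-- of its edges, i.e. is joined by it to exactly one vertex.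
record PerfectMatching (N : ℕ) : Set where
  field
    has         : Fin N → Fin N → Bool
    symmetric   : ∀ i j → has i j ≡ has j i
    irreflexive : ∀ i → has i i ≡ false
    perfect     : ∀ i → ∃! _≡_ λ j → has i j ≡ true

open PerfectMatching public

-- Two matchings are equal when they have the same edges, whatever the
-- accompanying proofs.
𝓜 : ℕ → Setoid 0ℓ 0ℓ
𝓜 N = record
  { Carrier = PerfectMatching N
  ; _≈_ = λ m m′ → ∀ i j → has m i j ≡ has m′ i j
  ; isEquivalence = record
    { refl  = λ _ _ → refl
    ; sym   = λ p i j → sym (p i j)
    ; trans = λ p q i j → trans (p i j) (q i j)
    }
  }

BooleanFunction : ℕ → Set
BooleanFunction N = 𝓜 N ⟶ₛ setoid Bool

partner : ∀ {N} → Fin N → PerfectMatching N → Fin N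
partner i m = proj₁ (perfect m i)

meetsTriangle : ∀ {N} → Fin N → Fin N → Fin N → PerfectMatching N → Bool
meetsTriangle i j k m = has m i j ∨ has m j k ∨ has m k i

-- The edge {i , j} is listed once, with its smaller endpoint first.
record Edge (N : ℕ) : Set where
  constructor edge
  field
    {i j} : Fin N
    i<j   : i <ᶠ j

⟦_⟧ᵇ : Bool → ℝ
⟦ b ⟧ᵇ = if b then 1ᵣ else 0ᵣ

x[_] : ∀ {N} → Edge N → PerfectMatching N → ℝ
x[ edge {i} {j} _ ] m = ⟦ has m i j ⟧ᵇ

-- A polynomial is a formal sum of terms, and a term is a coefficient
-- together with the list of variables, possibly repeated, multiplied by it.
Term : ℕ → Set
Term N = ℝ × List (Edge N)

Polynomial : ℕ → Set
Polynomial N = List (Term N)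

evalMonomial : ∀ {N} → List (Edge N) → PerfectMatching N → ℝ
evalMonomial []       m = 1ᵣ
evalMonomial (e ∷ es) m = x[ e ] m *ᵣ evalMonomial es m

eval : ∀ {N} → Polynomial N → PerfectMatching N → ℝ
eval []             m = 0ᵣ
eval ((c , es) ∷ p) m = c *ᵣ evalMonomial es m +ᵣ eval p m

HasDegree≤ : ∀ {N} → ℕ → Polynomial N → Set
HasDegree≤ d = All λ (_ , es) → length es ≤ⁿ d

DegreeAtMost : ∀ {N} → ℕ → BooleanFunction N → Set
DegreeAtMost d f = ∃[ p ] HasDegree≤ d p × (∀ m → eval p m ≈ᵣ ⟦ Func.to f m ⟧ᵇ)

DependsOnlyOn : ∀ {N} {A : Set} → BooleanFunction N → (PerfectMatching N → A) → Set
DependsOnlyOn f π = ∀ m m′ → π m ≡ π m′ → Func.to f m ≡ Func.to f m′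

IsConstant : ∀ {N} → BooleanFunction N → Set
IsConstant f = ∃[ b ] (∀ m → Func.to f m ≡ b)

DependsOnPartner : ∀ {N} → BooleanFunction N → Set
DependsOnPartner f = ∃[ i ] DependsOnlyOn f (partner i)

DependsOnTriangle : ∀ {N} → BooleanFunction N → Set
DependsOnTriangle f = ∃[ i ] ∃[ j ] ∃[ k ]
  i ≢ j × j ≢ k × k ≢ i × DependsOnlyOn f (meetsTriangle i j k)

{-# OPTIONS --safe #-}

-- A switch replaces edges ab, cd of a matching by ac, bd.  If f has degree at
-- most 1, its change under a switch does not depend on the rest of the
-- matching, so the three pairings of a 4-set of vertices either all give f the
-- same value (the set is inactive) or exactly one of them is odd.  On six
-- vertices f becomes a function on the 15 matchings of K₆ with the same sum over
-- each of the six 1-factorizations; this leaves 172 functions, and everything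
-- needed about at most six vertices is checked on them.
--
-- Let ab|cd be the odd pairing of some active 4-set Q.  If for some x in Q every
-- 4-set Q ∖ {x} ∪ {e} is inactive, then so is every 4-set avoiding x, and f
-- depends only on the partner of x.  Otherwise there is a set U of vertices such
-- that switches change f exactly as they change the number of edges inside U.
-- Two disjoint active 4-sets would make f take three values, so U or its
-- complement is a triangle.  Since matchings can be joined by switches that
-- never touch a vertex on which they already agree, these local descriptions
-- determine f.

module Submission where

open import Defs
open import Data.Nat.Base using (ℕ; _*_)
open import Data.Sum.Base using (_⊎_)
open import Function.Bundles using (_⇔_)

open import Algebra.Bundles using (CommutativeMonoid)
import Algebra.Properties.CommutativeSemigroup as CommutativeSemigroupProperties
import Algebra.Properties.Group as GroupProperties
import Algebra.Properties.Monoid.Mult as Mult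
open import Data.Bool.Base using (Bool; true; false; _∧_; _∨_; not; _xor_; if_then_else_)
import Data.Bool.Properties as Bool
open import Data.Empty using (⊥; ⊥-elim)
open import Data.Fin using (#_)
open import Data.Fin.Base using (Fin; zero; suc; combine; remQuot; opposite)
open import Data.Fin.Patterns
open import Data.Fin.Permutation.Components using (transpose; transpose-inverse)
open import Data.Fin.Properties
  using (_≟_; all?; any?; <-cmp; suc-injective; combine-remQuot; remQuot-combine; opposite-involutive)
open import Data.List.Base as List using (List; []; _∷_; length; map; allFin)
open import Data.List.Membership.Propositional using (_∈_)
open import Data.List.Membership.Propositional.Properties using (∈-allFin)
open import Data.List.Properties using (length-map)
open import Data.List.Relation.Unary.All using ([]; _∷_)
open import Data.List.Relation.Unary.Any using (here; there)
open import Data.Nat.Base using (zero; suc; _+_; z≤n; s≤s; _≡ᵇ_)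
open import Data.Nat.ListAction using (sum)
import Data.Nat.Properties as ℕ
open import Data.Product using (_×_; _,_; proj₁; proj₂; ∃)
open import Data.Rational.Base using (ℚ; 0ℚ; 1ℚ; ∣_∣)
  renaming (_+_ to _+ℚ_; _*_ to _*ℚ_; _-_ to _-ℚ_; _≤_ to _≤ℚ_; _<_ to _<ℚ_)
import Data.Rational.Properties as ℚ
open import Data.Sum.Base using (inj₁; inj₂)
open import Data.Unit.Base using (⊤; tt)
open import Data.Vec.Base using (Vec; []; _∷_; lookup; tabulate)
open import Data.Vec.Properties using (lookup∘tabulate; tabulate-cong)
open import Data.Vec.Relation.Unary.All using ([]; _∷_)
open import Data.Vec.Relation.Unary.AllPairs using ([]; _∷_)
open import Data.Vec.Relation.Unary.Unique.Propositional using (Unique)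
open import Data.Vec.Relation.Unary.Unique.Propositional.Properties using (lookup-injective)
open import Function.Base using (_∘_; case_of_)
open import Function.Bundles using (Func; mk⇔)
open import Relation.Binary.Definitions using (tri<; tri≈; tri>)
open import Relation.Binary.PropositionalEquality
  using (_≡_; _≢_; _≗_; refl; sym; trans; cong; cong₂; subst; subst₂; ≢-sym; module ≡-Reasoning)
open import Relation.Nullary.Decidable
  using (Dec; does; dec-true; dec-false; yes; no; ¬?; _×-dec_; _→-dec_; from-yes)
open import Relation.Nullary.Negation using (¬_; contradiction)

open Mult ℚ.+-0-monoid using () renaming (_×_ to _×ℚ_)
open CommutativeSemigroupProperties
  (CommutativeMonoid.commutativeSemigroup ℚ.+-0-commutativeMonoid) using (interchange)
open ≡-Reasoning

-- On four vertices every function of the three matchings has degree at most 1, so six vertices are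
-- the smallest test that says anything. There the edge indicators span a space of dimension 10
-- inside the 15-dimensional space of all functions, and the six 1-factorizations give 5 independent
-- equations. Equal sums therefore describe degree at most 1 exactly. The 172 solutions are 2
-- constants, 30 for a single edge or its negation, 120 for two or three of the edges at one vertex,
-- and 20 for triangles: a matching of K₆ meets a triangle exactly when it meets the complementary
-- one.
--
-- The obstacle is to glue the descriptions on overlapping 6-sets. On one of them a single edge
-- looks like a star at either end, and a set U cannot be told from its complement. Fixing one odd
-- pairing ab|cd and putting a, b into U settles the complement; the alternative about 4-sets that
-- exchange one vertex of Q settles the rest.

bit : Bool → ℕ
bit b = if b then 1 else 0

count : ∀ {A : Set} → (A → Bool) → List A → ℕ
count P xs = sum (map (bit ∘ P) xs)

⟦_⟧ℚ : Bool → ℚ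
⟦ b ⟧ℚ = if b then 1ℚ else 0ℚ

-- Sums of a degree-1 function over lists of matchings

module _ {A : Set} where

  ∑ : (A → ℚ) → List A → ℚ
  ∑ u []       = 0ℚ
  ∑ u (x ∷ xs) = u x +ℚ ∑ u xs

  ∑-cong : ∀ {u v} → (∀ x → u x ≡ v x) → ∀ xs → ∑ u xs ≡ ∑ v xs
  ∑-cong u≗v []       = refl
  ∑-cong u≗v (x ∷ xs) = cong₂ _+ℚ_ (u≗v x) (∑-cong u≗v xs)

  ∑-linear : ∀ k u v xs → ∑ (λ x → k *ℚ u x +ℚ v x) xs ≡ k *ℚ ∑ u xs +ℚ ∑ v xs
  ∑-linear k u v []       = sym (trans (ℚ.+-identityʳ (k *ℚ 0ℚ)) (ℚ.*-zeroʳ k))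
  ∑-linear k u v (x ∷ xs) = begin
    (k *ℚ u x +ℚ v x) +ℚ ∑ (λ y → k *ℚ u y +ℚ v y) xs  ≡⟨ cong (k *ℚ u x +ℚ v x +ℚ_) (∑-linear k u v xs) ⟩
    (k *ℚ u x +ℚ v x) +ℚ (k *ℚ ∑ u xs +ℚ ∑ v xs)       ≡⟨ interchange (k *ℚ u x) (v x) (k *ℚ ∑ u xs) (∑ v xs) ⟩
    (k *ℚ u x +ℚ k *ℚ ∑ u xs) +ℚ (v x +ℚ ∑ v xs)       ≡⟨ cong (_+ℚ (v x +ℚ ∑ v xs)) (ℚ.*-distribˡ-+ k (u x) (∑ u xs)) ⟨
    k *ℚ (u x +ℚ ∑ u xs) +ℚ (v x +ℚ ∑ v xs)           ∎

  ∑-bits : ∀ P xs → ∑ (⟦_⟧ℚ ∘ P) xs ≡ count P xs ×ℚ 1ℚ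
  ∑-bits P []       = refl
  ∑-bits P (x ∷ xs) with P x
  ... | true  = cong (1ℚ +ℚ_) (∑-bits P xs)
  ... | false = trans (ℚ.+-identityˡ _) (∑-bits P xs)

  ∑-zero : ∀ xs → ∑ (λ _ → 0ℚ) xs ≡ 0ℚ
  ∑-zero []       = refl
  ∑-zero (_ ∷ xs) = trans (ℚ.+-identityˡ _) (∑-zero xs)

  ∑-one : ∀ xs → ∑ (λ _ → 1ℚ) xs ≡ length xs ×ℚ 1ℚ
  ∑-one []       = refl
  ∑-one (x ∷ xs) = cong (1ℚ +ℚ_) (∑-one xs)

  ∑ᵣ : (A → ℝ) → List A → ℝ
  ∑ᵣ u []       = 0ᵣ
  ∑ᵣ u (x ∷ xs) = u x +ᵣ ∑ᵣ u xs

  ∑ᵣ-cong : ∀ {u v} → (∀ x → u x ≈ᵣ v x) → ∀ xs → ∑ᵣ u xs ≈ᵣ ∑ᵣ v xs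
  ∑ᵣ-cong u≈v []       = ≗⇒≈ᵣ {0ᵣ} {0ᵣ} λ _ → refl
  ∑ᵣ-cong {u} {v} u≈v (x ∷ xs) =
    +ᵣ-cong {u x} {v x} {∑ᵣ u xs} {∑ᵣ v xs} (u≈v x) (∑ᵣ-cong u≈v xs)

  seq-∑ᵣ : ∀ u xs k → seq (∑ᵣ u xs) k ≡ ∑ (λ x → seq (u x) k) xs
  seq-∑ᵣ u []       k = refl
  seq-∑ᵣ u (x ∷ xs) k = cong (seq (u x) k +ℚ_) (seq-∑ᵣ u xs k)

0≤n×1 : ∀ n → 0ℚ ≤ℚ n ×ℚ 1ℚ
0≤n×1 zero    = ℚ.≤-refl
0≤n×1 (suc n) = ℚ.+-mono-≤ (ℚ.nonNegative⁻¹ 1ℚ) (0≤n×1 n)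

0≢1+n×1 : ∀ n → 0ℚ ≢ 1ℚ +ℚ (n ×ℚ 1ℚ)
0≢1+n×1 n = ℚ.<⇒≢ (ℚ.+-mono-<-≤ (ℚ.positive⁻¹ 1ℚ) (0≤n×1 n))

×1-injective : ∀ m n → m ×ℚ 1ℚ ≡ n ×ℚ 1ℚ → m ≡ n
×1-injective zero    zero    _  = refl
×1-injective zero    (suc n) eq = ⊥-elim (0≢1+n×1 n eq)
×1-injective (suc m) zero    eq = ⊥-elim (0≢1+n×1 m (sym eq))
×1-injective (suc m) (suc n) eq = cong suc (×1-injective m n
  (GroupProperties.∙-cancelˡ ℚ.+-0-group 1ℚ _ _ eq))

arbitrarilyClose⇒≡ : ∀ p q → (∀ ε → 0ℚ <ℚ ε → ∣ p -ℚ q ∣ <ℚ ε) → p ≡ q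
arbitrarilyClose⇒≡ p q close = GroupProperties.x∙y⁻¹≈ε⇒x≈y ℚ.+-0-group p q
  (ℚ.∣p∣≡0⇒p≡0 (p -ℚ q) (ℚ.≤-antisym (ℚ.≮⇒≥ λ 0<d → ℚ.<-irrefl refl (close _ 0<d))
                                    (ℚ.0≤∣p∣ (p -ℚ q))))

constant-≈ᵣ⇒≡ : ∀ {x y p q} → (∀ k → seq x k ≡ p) → (∀ k → seq y k ≡ q) → x ≈ᵣ y → p ≡ q
constant-≈ᵣ⇒≡ x≡p y≡q x≈y = arbitrarilyClose⇒≡ _ _ λ ε 0<ε →
  let K , close = x≈y ε 0<ε in
  subst₂ (λ p q → ∣ p -ℚ q ∣ <ℚ ε) (x≡p K) (y≡q K) (close K ℕ.≤-refl)

seq-bit : ∀ b k → seq ⟦ b ⟧ᵇ k ≡ ⟦ b ⟧ℚ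
seq-bit true  k = refl
seq-bit false k = refl

-- Two lists of matchings using every edge equally often have equal sums of f.
module _ {N : ℕ} {ms ms′ : List (PerfectMatching N)}
         (length≡ : length ms ≡ length ms′)
         (edges≡ : ∀ (i j : Fin N) → count (λ m → has m i j) ms ≡ count (λ m → has m i j) ms′) where

  Balanced : (PerfectMatching N → ℚ) → Set
  Balanced u = ∑ u ms ≡ ∑ u ms′

  balanced-cong : ∀ {u v} → (∀ m → u m ≡ v m) → Balanced u → Balanced v
  balanced-cong u≗v b = trans (sym (∑-cong u≗v ms)) (trans b (∑-cong u≗v ms′))

  balanced-linear : ∀ k {u v} → Balanced u → Balanced v → Balanced (λ m → k *ℚ u m +ℚ v m)
  balanced-linear k {u} {v} bu bv = trans (∑-linear k u v ms)
    (trans (cong₂ (λ p q → k *ℚ p +ℚ q) bu bv) (sym (∑-linear k u v ms′)))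

  balanced-zero : Balanced (λ _ → 0ℚ)
  balanced-zero = trans (∑-zero ms) (sym (∑-zero ms′))

  balanced-one : Balanced (λ _ → 1ℚ)
  balanced-one = trans (∑-one ms) (trans (cong (_×ℚ 1ℚ) length≡) (sym (∑-one ms′)))

  balanced-has : ∀ i j → Balanced (λ m → ⟦ has m i j ⟧ℚ)
  balanced-has i j = trans (∑-bits hasᵢⱼ ms)
    (trans (cong (_×ℚ 1ℚ) (edges≡ i j)) (sym (∑-bits hasᵢⱼ ms′)))
    where hasᵢⱼ = λ m → has m i j

  balanced-eval : ∀ p → HasDegree≤ 1 p → ∀ k → Balanced (λ m → seq (eval p m) k)
  balanced-eval []                                _        k = balanced-zero
  balanced-eval ((c , []) ∷ p)                    (_ ∷ d)  k =
    balanced-linear (seq c k) balanced-one (balanced-eval p d k)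
  balanced-eval ((c , edge {i} {j} _ ∷ []) ∷ p)   (_ ∷ d)  k =
    balanced-linear (seq c k)
      (balanced-cong (λ m → trans (sym (seq-bit (has m i j) k)) (sym (ℚ.*-identityʳ _)))
        (balanced-has i j))
      (balanced-eval p d k)
  balanced-eval ((c , _ ∷ _ ∷ _) ∷ p)             (s≤s () ∷ d) k

  -- The sums of f are constant sequences of natural numbers, so equality of their limits is
  -- equality of the numbers. This is the only property of degree 1 used in the classification.
  count-balanced : ∀ f → DegreeAtMost 1 f → count (Func.to f) ms ≡ count (Func.to f) ms′
  count-balanced f (p , d , p≈f) = ×1-injective _ _
    (constant-≈ᵣ⇒≡ {∑ᵣ g ms} {∑ᵣ g ms′} (seq-∑g ms) (seq-∑g ms′)
      (≈ᵣ-trans {∑ᵣ g ms} {∑ᵣ (eval p) ms} {∑ᵣ g ms′}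
        (≈ᵣ-sym {∑ᵣ (eval p) ms} {∑ᵣ g ms} (∑ᵣ-cong p≈f ms))
        (≈ᵣ-trans {∑ᵣ (eval p) ms} {∑ᵣ (eval p) ms′} {∑ᵣ g ms′}
          (≗⇒≈ᵣ {∑ᵣ (eval p) ms} {∑ᵣ (eval p) ms′} λ k →
            trans (seq-∑ᵣ (eval p) ms k)
              (trans (balanced-eval p d k) (sym (seq-∑ᵣ (eval p) ms′ k))))
          (∑ᵣ-cong p≈f ms′))))
    where
    g : PerfectMatching N → ℝ
    g m = ⟦ Func.to f m ⟧ᵇ
    seq-∑g : ∀ ls k → seq (∑ᵣ g ls) k ≡ count (Func.to f) ls ×ℚ 1ℚ
    seq-∑g ls k = trans (seq-∑ᵣ g ls k)
      (trans (∑-cong (λ m → seq-bit (Func.to f m) k) ls) (∑-bits (Func.to f) ls))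

-- Perfect matchings as involutions, and switches

module _ {N : ℕ} where

  infixl 8 _·_

  _·_ : PerfectMatching N → Fin N → Fin N
  m · i = partner i m

  has-partner : ∀ m i → has m i (m · i) ≡ true
  has-partner m i = proj₁ (proj₂ (perfect m i))

  partner-unique : ∀ m {i j} → has m i j ≡ true → m · i ≡ j
  partner-unique m {i} h = proj₂ (proj₂ (perfect m i)) h

  has-does : ∀ m i j → has m i j ≡ does (m · i ≟ j)
  has-does m i j with m · i ≟ j
  ... | yes refl = has-partner m i
  ... | no  neq  = Bool.¬-not (neq ∘ partner-unique m)

  ·-involutive : ∀ m i → m · (m · i) ≡ i
  ·-involutive m i = partner-unique m (trans (symmetric m _ i) (has-partner m i))

  ·-irreflexive : ∀ m i → m · i ≢ i
  ·-irreflexive m i eq = case trans (sym (has-partner m i)) (trans (cong (has m i) eq) (irreflexive m i)) of λ ()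

  ·-swap : ∀ m {i j} → m · i ≡ j → m · j ≡ i
  ·-swap m {i} eq = trans (cong (m ·_) (sym eq)) (·-involutive m i)

  ·-injective : ∀ m {i j} → m · i ≡ m · j → i ≡ j
  ·-injective m {i} {j} eq = trans (sym (·-involutive m i)) (·-swap m (sym eq))

  module _ (p : Fin N → Fin N) (p-involutive : ∀ (i : Fin N) → p (p i) ≡ i) (p-irreflexive : ∀ (i : Fin N) → p i ≢ i) where

    fromInvolution : PerfectMatching N
    fromInvolution = record
      { has         = λ i j → does (p i ≟ j)
      ; symmetric   = symm
      ; irreflexive = λ i → dec-false (p i ≟ i) (p-irreflexive i)
      ; perfect     = λ i → p i , dec-true (p i ≟ p i) refl , λ {j} → unique i j
      }
      where
      symm : ∀ i j → does (p i ≟ j) ≡ does (p j ≟ i)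
      symm i j with p i ≟ j
      ... | yes refl = sym (dec-true (p (p i) ≟ i) (p-involutive i))
      ... | no  neq  = sym (dec-false (p j ≟ i) λ { refl → neq (p-involutive j) })
      unique : ∀ i j → does (p i ≟ j) ≡ true → p i ≡ j
      unique i j h with yes eq ← p i ≟ j = eq

  respects : ∀ (f : BooleanFunction N) {m m′} → m ·_ ≗ m′ ·_ → Func.to f m ≡ Func.to f m′
  respects f {m} {m′} eq = Func.cong f λ i j →
    trans (has-does m i j) (trans (cong (λ k → does (k ≟ j)) (eq i)) (sym (has-does m′ i j)))

  -- The field `b≢c` says that ab and cd are two different edges; the remaining inequalities follow
  -- from it and from the absence of fixed points.
  record Switch (a b c d : Fin N) (m m′ : PerfectMatching N) : Set where
    field
      b≢c  : b ≢ c
      ab   : m · a ≡ b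
      cd   : m · c ≡ d
      ac   : m′ · a ≡ c
      bd   : m′ · b ≡ d
      rest : ∀ x → x ≢ a → x ≢ b → x ≢ c → x ≢ d → m · x ≡ m′ · x

    a≢b : a ≢ b
    a≢b refl = ·-irreflexive m a ab

    c≢d : c ≢ d
    c≢d refl = ·-irreflexive m c cd

    a≢c : a ≢ c
    a≢c refl = ·-irreflexive m′ a ac

    b≢d : b ≢ d
    b≢d refl = ·-irreflexive m′ b bd

    a≢d : a ≢ d
    a≢d refl = b≢c (trans (sym ab) (·-swap m cd))

  -- At the four switched vertices both switches do the same, elsewhere neither does anything. Hence
  -- m₁ and m₂′ together use the same edges as m₁′ and m₂.
  switch-agree : ∀ {a b c d m₁ m₁′ m₂ m₂′} → Switch a b c d m₁ m₁′ → Switch a b c d m₂ m₂′ →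
    ∀ i → (m₁ · i ≡ m₂ · i × m₁′ · i ≡ m₂′ · i) ⊎ (m₁ · i ≡ m₁′ · i × m₂ · i ≡ m₂′ · i)
  switch-agree {a} {b} {c} {d} {m₁} {m₁′} {m₂} {m₂′} s₁ s₂ i with i ≟ a | i ≟ b | i ≟ c | i ≟ d
  ... | yes refl | _ | _ | _ = inj₁ (trans (ab s₁) (sym (ab s₂)) , trans (ac s₁) (sym (ac s₂)))
    where open Switch
  ... | _ | yes refl | _ | _ = inj₁ (trans (·-swap m₁ (ab s₁)) (sym (·-swap m₂ (ab s₂))) , trans (bd s₁) (sym (bd s₂)))
    where open Switch
  ... | _ | _ | yes refl | _ = inj₁ (trans (cd s₁) (sym (cd s₂)) , trans (·-swap m₁′ (ac s₁)) (sym (·-swap m₂′ (ac s₂))))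
    where open Switch
  ... | _ | _ | _ | yes refl = inj₁ (trans (·-swap m₁ (cd s₁)) (sym (·-swap m₂ (cd s₂)))
                                    , trans (·-swap m₁′ (bd s₁)) (sym (·-swap m₂′ (bd s₂))))
    where open Switch
  ... | no i≢a | no i≢b | no i≢c | no i≢d =
    inj₂ (Switch.rest s₁ i i≢a i≢b i≢c i≢d , Switch.rest s₂ i i≢a i≢b i≢c i≢d)

  transpose-left : ∀ (i j : Fin N) → transpose i j i ≡ j
  transpose-left i j rewrite dec-true (i ≟ i) refl = refl

  transpose-right : ∀ (i j : Fin N) → transpose i j j ≡ i
  transpose-right i j with j ≟ i
  ... | yes eq = eq
  ... | no  _ rewrite dec-true (j ≟ j) refl = refl

  transpose-other : ∀ {i j k : Fin N} → k ≢ i → k ≢ j → transpose i j k ≡ k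
  transpose-other {i} {j} {k} k≢i k≢j rewrite dec-false (k ≟ i) k≢i | dec-false (k ≟ j) k≢j = refl

  relabel : Fin N → Fin N → PerfectMatching N → PerfectMatching N
  relabel i j m = fromInvolution (λ x → transpose i j (m · transpose j i x))
    (λ x → trans (cong (transpose i j) (trans (cong (m ·_) (transpose-inverse j i)) (·-involutive m _)))
                 (transpose-inverse i j))
    (λ x eq → ·-irreflexive m (transpose j i x)
       (trans (sym (transpose-inverse j i)) (cong (transpose j i) eq)))

  opaque

    -- Conjugating by the transposition of c and the partner of a is the switch that creates ac.
    join : Fin N → Fin N → PerfectMatching N → PerfectMatching N
    join a c m = relabel (m · a) c m

    -- If a and c are already matched, the transposition is trivial, so this case needs no separate
    -- treatment.
    join-edge : ∀ m {a c} → a ≢ c → join a c m · a ≡ c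
    join-edge m {a} {c} a≢c = trans
      (cong (λ x → transpose (m · a) c (m · x)) (transpose-other a≢c (≢-sym (·-irreflexive m a))))
      (transpose-left (m · a) c)

    join-other : ∀ m {a c x} → x ≢ a → x ≢ m · a → x ≢ c → x ≢ m · c → join a c m · x ≡ m · x
    join-other m {a} {c} {x} x≢a x≢ma x≢c x≢mc = trans
      (cong (λ y → transpose (m · a) c (m · y)) (transpose-other x≢c x≢ma))
      (transpose-other (x≢a ∘ ·-injective m) (x≢mc ∘ sym ∘ ·-swap m))

    join-switch : ∀ m {a c} → a ≢ c → m · a ≢ c → Switch a (m · a) c (m · c) m (join a c m)
    join-switch m {a} {c} a≢c ma≢c = record
      { b≢c = ma≢c ; ab = refl ; cd = refl ; ac = join-edge m a≢c
      ; bd = trans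
          (cong (λ x → transpose (m · a) c (m · x)) (transpose-right c (m · a)))
          (transpose-other (a≢c ∘ ·-injective m ∘ sym) (·-irreflexive m c))
      ; rest = λ x x≢a x≢ma x≢c x≢mc → sym (join-other m x≢a x≢ma x≢c x≢mc) }

  join-keeps : ∀ m {a c x y} → x ≢ a → x ≢ c → y ≢ a → y ≢ c → m · x ≡ y → join a c m · x ≡ y
  join-keeps m x≢a x≢c y≢a y≢c refl = join-other m x≢a
    (λ eq → y≢a (·-swap m (sym eq))) x≢c (λ eq → y≢c (·-swap m (sym eq)))

-- A starting point: the sample matchings behind `S` and behind the converse are made from it by
-- `join`.
standardMatching : ∀ n → PerfectMatching (2 * n)
standardMatching n = fromInvolution flip flip-involutive flip-irreflexive
  where
  half : Fin (2 * n) → Fin 2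
  half x = proj₁ (remQuot {2} n x)

  place : Fin (2 * n) → Fin n
  place x = proj₂ (remQuot {2} n x)

  flip : Fin (2 * n) → Fin (2 * n)
  flip x = combine (opposite (half x)) (place x)

  half-flip : ∀ x → half (flip x) ≡ opposite (half x)
  half-flip x = cong proj₁ (remQuot-combine (opposite (half x)) (place x))

  place-flip : ∀ x → place (flip x) ≡ place x
  place-flip x = cong proj₂ (remQuot-combine (opposite (half x)) (place x))

  flip-involutive : ∀ x → flip (flip x) ≡ x
  flip-involutive x = trans
    (cong₂ combine (trans (cong opposite (half-flip x)) (opposite-involutive (half x))) (place-flip x))
    (combine-remQuot {2} n x)

  opposite-irreflexive : ∀ (q : Fin 2) → opposite q ≢ q
  opposite-irreflexive 0F ()
  opposite-irreflexive 1F ()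

  flip-irreflexive : ∀ x → flip x ≢ x
  flip-irreflexive x eq = opposite-irreflexive (half x) (trans (sym (half-flip x)) (cong half eq))

-- Boolean statements about at most six vertices

infix  7 _==_
infixr 4 _⇒_

_==_ : Bool → Bool → Bool
p == q = not (p xor q)

_⇒_ : Bool → Bool → Bool
p ⇒ q = not p ∨ q

mp : ∀ {p q} → (p ⇒ q) ≡ true → p ≡ true → q ≡ true
mp h refl = h

∧-left : ∀ {p q} → p ∧ q ≡ true → p ≡ true
∧-left {true} _ = refl

∧-right : ∀ {p q} → p ∧ q ≡ true → q ≡ true
∧-right {true} h = h

allBits : ∀ n → (Vec Bool n → Bool) → Bool
allBits zero    P = P []
allBits (suc n) P = allBits n (λ b → P (true ∷ b)) ∧ allBits n (λ b → P (false ∷ b))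

allBits-sound : ∀ n P → allBits n P ≡ true → ∀ b → P b ≡ true
allBits-sound zero    P h []          = h
allBits-sound (suc n) P h (true ∷ b)  = allBits-sound n _ (∧-left h) b
allBits-sound (suc n) P h (false ∷ b) =
  allBits-sound n _ (∧-right {allBits n (λ b → P (true ∷ b))} h) b

-- Whether xy|zw and xz|yw have equally many edges inside a set U, where p, q, r, s
-- are the memberships of x, y, z, w: pq + rs - pr - qs = (p - s)(q - r).
cut : Bool → Bool → Bool → Bool → Bool
cut p q r s = p == s ∨ q == r

Rel : Set → Set
Rel X = X → X → X → X → Bool

-- Here s x y z w stands for: the switch from xy|zw to xz|yw does not change f.
module _ {X : Set} (s : Rel X) where

  -- ab|cd differs from both other pairings of the 4-set.
  odd : X → X → X → X → Bool
  odd a b c d = not (s a b c d) ∧ not (s a b d c)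

  inactive : X → X → X → X → Bool
  inactive x y z w = s x y z w ∧ s x y w z

  fitAs : Bool → Bool → Bool → Bool → X → X → X → X → Bool
  fitAs p q r t x y z w = (s x y z w == cut p q r t) ∧ (s x y w z == cut p q t r)

  fit : (X → Bool) → X → X → X → X → Bool
  fit τ x y z w = fitAs (τ x) (τ y) (τ z) (τ w) x y z w

-- Here Q is 0123. The hypotheses of `pairFact`, and likewise those of `spreadFact`, leave only
-- functions of the partner of 0. In `typesFact` the four equalities exclude every star except the
-- single edges 01 and 23, so f or its negation is a single edge or a triangle, and `τ` is the
-- corresponding U, with two, three or four vertices.
pairFact spreadFact typesFact : Rel (Fin 6) → Bool
pairFact s = odd s 0F 1F 2F 3F ⇒ inactive s 1F 2F 3F 4F ⇒ inactive s 1F 2F 3F 5F ⇒ inactive s 1F 2F 4F 5F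
spreadFact s = odd s 0F 1F 2F 3F ⇒ inactive s 1F 2F 3F 5F ⇒ not (inactive s 0F 2F 3F 5F) ⇒ inactive s 1F 2F 3F 4F
typesFact s = odd s 0F 1F 2F 3F
  ⇒ (inactive s 1F 2F 3F 4F == inactive s 0F 2F 3F 4F)
  ⇒ (inactive s 3F 0F 1F 4F == inactive s 2F 0F 1F 4F)
  ⇒ (inactive s 1F 2F 3F 5F == inactive s 0F 2F 3F 5F)
  ⇒ (inactive s 3F 0F 1F 5F == inactive s 2F 0F 1F 5F)
  ⇒ (not (inactive s 1F 2F 3F 4F == inactive s 3F 0F 1F 4F)
     ∧ (fit s τ 2F 3F 0F 4F ∧ fit s τ 2F 3F 1F 4F ∧ fit s τ 2F 3F 4F 5F))
  where
  τ : Fin 6 → Bool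
  τ = lookup (true ∷ true ∷ false ∷ false ∷ inactive s 3F 0F 1F 4F ∷ inactive s 3F 0F 1F 5F ∷ [])

-- A statement about the five vertices 0 to 4. The vertex 5 is present because five vertices carry
-- no perfect matching to check it on.
propagateFact : Rel (Fin 6) → Vec Bool 6 → Bool
propagateFact s t = fit s (lookup t) 0F 1F 2F 3F ⇒ fit s (lookup t) 0F 1F 2F 4F ⇒ fit s (lookup t) 0F 1F 3F 4F ⇒
  (fit s (lookup t) 0F 2F 3F 4F ∧ fit s (lookup t) 1F 2F 3F 4F)

facts₆ : Rel (Fin 6) → Bool
facts₆ s = pairFact s ∧ (spreadFact s ∧ (typesFact s ∧ allBits 6 (propagateFact s)))

-- For `orientFact`: if two of the three pairings have different Boolean values, the third agrees
-- with one of them and makes the other one odd.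
relabelFact orientFact : Rel (Fin 4) → Bool
relabelFact s = odd s 0F 1F 2F 3F ⇒
  odd s 1F 0F 2F 3F ∧ odd s 2F 3F 0F 1F ∧ odd s 3F 2F 0F 1F
  ∧ fit s (lookup (true ∷ true ∷ false ∷ false ∷ [])) 2F 3F 0F 1F
orientFact s = not (s 0F 1F 2F 3F) ⇒ odd s 0F 1F 2F 3F ∨ odd s 0F 2F 1F 3F

swapFact : Rel (Fin 4) → Vec Bool 4 → Bool
swapFact s t = fit s (lookup t) 0F 1F 2F 3F ⇒
  fit s (lookup t) 1F 0F 2F 3F ∧ fit s (lookup t) 0F 2F 1F 3F ∧ fit s (lookup t) 0F 1F 3F 2F

facts₄ : Rel (Fin 4) → Bool
facts₄ s = relabelFact s ∧ (orientFact s ∧ allBits 4 (swapFact s))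

if-does-cong : ∀ {A B : Set} {x y z : B} (d : Dec A) → (A → x ≡ y) →
  (if does d then x else z) ≡ (if does d then y else z)
if-does-cong (yes a) eq = eq a
if-does-cong (no _)  eq = refl

module _ {k : ℕ} where

  Distinct : Fin k → Fin k → Fin k → Fin k → Set
  Distinct i j p q = i ≢ j × i ≢ p × i ≢ q × j ≢ p × j ≢ q × p ≢ q

  distinct? : ∀ i j p q → Dec (Distinct i j p q)
  distinct? i j p q = ¬? (i ≟ j) ×-dec ¬? (i ≟ p) ×-dec ¬? (i ≟ q)
    ×-dec ¬? (j ≟ p) ×-dec ¬? (j ≟ q) ×-dec ¬? (p ≟ q)

  -- Tabulated relations can be compared without function extensionality.
  Quad : Set
  Quad = Vec (Vec (Vec (Vec Bool k) k) k) k

  restrict : Rel (Fin k) → Quad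
  restrict s = tabulate λ i → tabulate λ j → tabulate λ p → tabulate λ q →
    -- At repeated vertices the relations carry no meaning; a common default lets two relations have
    -- equal tabulations as soon as they agree on distinct vertices.
    if does (distinct? i j p q) then s i j p q else true

  restrict-cong : ∀ {s s′} → (∀ {i j p q} → Distinct i j p q → s i j p q ≡ s′ i j p q) → restrict s ≡ restrict s′
  restrict-cong eq = tabulate-cong λ i → tabulate-cong λ j → tabulate-cong λ p → tabulate-cong λ q →
    if-does-cong (distinct? i j p q) eq

  read : Quad → Rel (Fin k)
  read v i j p q = lookup (lookup (lookup (lookup v i) j) p) q

-- Without a hit the last index is returned. The result is relied upon only for four distinct
-- vertices, where `Indexed` certifies it.
search : ∀ {n} → (Fin (suc n) → Bool) → Fin (suc n)
search {zero}  P = zero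
search {suc n} P = if P zero then zero else suc (search (λ i → P (suc i)))

module Table {k t : ℕ} (μ : Vec (Vec (Fin k) k) (suc t)) where

  -- The matching containing ij and pq, if the table has one.
  index : Fin k → Fin k → Fin k → Fin k → Fin (suc t)
  index i j p q = search λ n → does (lookup (lookup μ n) i ≟ j) ∧ does (lookup (lookup μ n) p ≟ q)

  rel : Vec Bool (suc t) → Fin k → Fin k → Fin k → Fin k → Bool
  rel b i j p q = lookup b (index i j p q) == lookup b (index i p j q)

matchings₆ : Vec (Vec (Fin 6) 6) 15
matchings₆ =
  (1F ∷ 0F ∷ 3F ∷ 2F ∷ 5F ∷ 4F ∷ []) ∷
  (1F ∷ 0F ∷ 4F ∷ 5F ∷ 2F ∷ 3F ∷ []) ∷
  (1F ∷ 0F ∷ 5F ∷ 4F ∷ 3F ∷ 2F ∷ []) ∷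
  (2F ∷ 3F ∷ 0F ∷ 1F ∷ 5F ∷ 4F ∷ []) ∷
  (2F ∷ 4F ∷ 0F ∷ 5F ∷ 1F ∷ 3F ∷ []) ∷
  (2F ∷ 5F ∷ 0F ∷ 4F ∷ 3F ∷ 1F ∷ []) ∷
  (3F ∷ 2F ∷ 1F ∷ 0F ∷ 5F ∷ 4F ∷ []) ∷
  (3F ∷ 4F ∷ 5F ∷ 0F ∷ 1F ∷ 2F ∷ []) ∷
  (3F ∷ 5F ∷ 4F ∷ 0F ∷ 2F ∷ 1F ∷ []) ∷
  (4F ∷ 2F ∷ 1F ∷ 5F ∷ 0F ∷ 3F ∷ []) ∷
  (4F ∷ 3F ∷ 5F ∷ 1F ∷ 0F ∷ 2F ∷ []) ∷
  (4F ∷ 5F ∷ 3F ∷ 2F ∷ 0F ∷ 1F ∷ []) ∷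
  (5F ∷ 2F ∷ 1F ∷ 4F ∷ 3F ∷ 0F ∷ []) ∷
  (5F ∷ 3F ∷ 4F ∷ 1F ∷ 2F ∷ 0F ∷ []) ∷
  (5F ∷ 4F ∷ 3F ∷ 2F ∷ 1F ∷ 0F ∷ []) ∷ []

-- The 1-factorizations of K₆, as indices into matchings₆.
factorization : Fin 6 → List (Fin 15)
factorization 0F = # 0 ∷ # 4 ∷ # 8 ∷ # 10 ∷ # 12 ∷ []
factorization 1F = # 0 ∷ # 5 ∷ # 7 ∷ # 9 ∷ # 13 ∷ []
factorization 2F = # 1 ∷ # 3 ∷ # 7 ∷ # 11 ∷ # 12 ∷ []
factorization 3F = # 1 ∷ # 5 ∷ # 6 ∷ # 10 ∷ # 14 ∷ []
factorization 4F = # 2 ∷ # 3 ∷ # 8 ∷ # 9 ∷ # 14 ∷ []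
factorization 5F = # 2 ∷ # 4 ∷ # 6 ∷ # 11 ∷ # 13 ∷ []

regular : Vec Bool 15 → Bool
regular b = w 1F ∧ w 2F ∧ w 3F ∧ w 4F ∧ w 5F
  where
  w : Fin 6 → Bool
  w n = count (lookup b) (factorization 0F) ≡ᵇ count (lookup b) (factorization n)

matchings₄ : Vec (Vec (Fin 4) 4) 3
matchings₄ = (1F ∷ 0F ∷ 3F ∷ 2F ∷ []) ∷ (2F ∷ 3F ∷ 0F ∷ 1F ∷ []) ∷ (3F ∷ 2F ∷ 1F ∷ 0F ∷ []) ∷ []

module Table₄ = Table matchings₄
module Table₆ = Table matchings₆

record Holds {k : ℕ} (P : Rel (Fin k) → Bool) (s : Rel (Fin k)) : Set where
  constructor holds
  field
    proof : P (read (restrict s)) ≡ true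

holds-cong : ∀ {k} {P : Rel (Fin k) → Bool} {s s′} →
  (∀ {i j p q} → Distinct i j p q → s i j p q ≡ s′ i j p q) → Holds P s → Holds P s′
holds-cong {P = P} eq (holds h) = holds (subst (λ r → P (read r) ≡ true) (restrict-cong eq) h)

facts₄-hold : ∀ b → Holds facts₄ (Table₄.rel b)
facts₄-hold b = holds (allBits-sound 3 (λ b → facts₄ (read (restrict (Table₄.rel b)))) refl b)

facts₆-hold : ∀ b → regular b ≡ true → Holds facts₆ (Table₆.rel b)
facts₆-hold b reg =
  -- All 32768 vectors are enumerated by computation. With `regular` as the first premise the
  -- implication is already true on the irregular ones, and `facts₆` is evaluated only on the
  -- others.
  holds (mp (allBits-sound 15 (λ b → regular b ⇒ facts₆ (read (restrict (Table₆.rel b)))) refl b) reg)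

module _ (s : Rel (Fin 4)) where

  -- At distinct numerals `s′` computes to `s`, and the facts mention no other arguments. What holds
  -- for `s′` is thus, by computation, the claim for `s`.
  private s′ = read (restrict s)

  relabel-holds : Holds facts₄ s → relabelFact s ≡ true
  relabel-holds (holds h) = ∧-left {relabelFact s′} {orientFact s′ ∧ allBits 4 (swapFact s′)} h

  orient-holds : Holds facts₄ s → orientFact s ≡ true
  orient-holds (holds h) = ∧-left {orientFact s′} {allBits 4 (swapFact s′)}
    (∧-right {relabelFact s′} {orientFact s′ ∧ allBits 4 (swapFact s′)} h)

  swap-holds : Holds facts₄ s → ∀ t → swapFact s t ≡ true
  swap-holds (holds h) t@(_ ∷ _ ∷ _ ∷ _ ∷ []) = allBits-sound 4 (swapFact s′)
    (∧-right {orientFact s′} {allBits 4 (swapFact s′)}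
      (∧-right {relabelFact s′} {orientFact s′ ∧ allBits 4 (swapFact s′)} h)) t

module _ (s : Rel (Fin 6)) where

  private
    s′ = read (restrict s)

    rest₂ = typesFact s′ ∧ allBits 6 (propagateFact s′)
    rest₁ = spreadFact s′ ∧ rest₂

  pairFact-holds : Holds facts₆ s → pairFact s ≡ true
  pairFact-holds (holds h) = ∧-left {pairFact s′} {rest₁} h

  spreadFact-holds : Holds facts₆ s → spreadFact s ≡ true
  spreadFact-holds (holds h) = ∧-left {spreadFact s′} {rest₂} (∧-right {pairFact s′} {rest₁} h)

  typesFact-holds : Holds facts₆ s → typesFact s ≡ true
  typesFact-holds (holds h) = ∧-left {typesFact s′} {allBits 6 (propagateFact s′)}
    (∧-right {spreadFact s′} {rest₂} (∧-right {pairFact s′} {rest₁} h))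

  propagateFact-holds : Holds facts₆ s → ∀ t → propagateFact s t ≡ true
  propagateFact-holds (holds h) t@(_ ∷ _ ∷ _ ∷ _ ∷ _ ∷ _ ∷ []) = allBits-sound 6 (propagateFact s′)
    (∧-right {typesFact s′} {allBits 6 (propagateFact s′)}
      (∧-right {spreadFact s′} {rest₂} (∧-right {pairFact s′} {rest₁} h))) t

module _ {k t : ℕ} (μ : Vec (Vec (Fin k) k) (suc t)) where

  private
    ν : Fin (suc t) → Fin k → Fin k
    ν n = lookup (lookup μ n)

  Involutions : Set
  Involutions = ∀ n i → ν n (ν n i) ≡ i × ν n i ≢ i

  involutions? : Dec Involutions
  involutions? = all? λ n → all? λ i → ν n (ν n i) ≟ i ×-dec ¬? (ν n i ≟ i)

  Indexed : Set
  Indexed = ∀ i j p q → Distinct i j p q →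
    let n = Table.index μ i j p q ; n′ = Table.index μ i p j q in
    ν n i ≡ j × ν n p ≡ q × ν n′ i ≡ p × ν n′ j ≡ q ×
    (∀ x → x ≢ i → x ≢ j → x ≢ p → x ≢ q → ν n x ≡ ν n′ x)

  indexed? : Dec Indexed
  indexed? = all? λ i → all? λ j → all? λ p → all? λ q → distinct? i j p q →-dec
    let n = Table.index μ i j p q ; n′ = Table.index μ i p j q in
    ν n i ≟ j ×-dec ν n p ≟ q ×-dec ν n′ i ≟ p ×-dec ν n′ j ≟ q ×-dec
    all? λ x → ¬? (x ≟ i) →-dec ¬? (x ≟ j) →-dec ¬? (x ≟ p) →-dec ¬? (x ≟ q) →-dec ν n x ≟ ν n′ x

involutions₄ : Involutions matchings₄
involutions₄ = from-yes (involutions? matchings₄)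

indexed₄ : Indexed matchings₄
indexed₄ = from-yes (indexed? matchings₄)

involutions₆ : Involutions matchings₆
involutions₆ = from-yes (involutions? matchings₆)

indexed₆ : Indexed matchings₆
indexed₆ = from-yes (indexed? matchings₆)

factorization-length : ∀ n → length (factorization 0F) ≡ length (factorization n)
factorization-length = from-yes (all? λ n → length (factorization 0F) ℕ.≟ length (factorization n))

factorization-edges : ∀ n i j →
  count (λ t → does (lookup (lookup matchings₆ t) i ≟ j)) (factorization 0F) ≡
  count (λ t → does (lookup (lookup matchings₆ t) i ≟ j)) (factorization n)
factorization-edges = from-yes (all? λ n → all? λ i → all? λ j →
  count (λ t → does (lookup (lookup matchings₆ t) i ≟ j)) (factorization 0F) ℕ.≟
  count (λ t → does (lookup (lookup matchings₆ t) i ≟ j)) (factorization n))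

count-cong : ∀ {A : Set} {P Q : A → Bool} → P ≗ Q → ∀ xs → count P xs ≡ count Q xs
count-cong P≗Q []       = refl
count-cong P≗Q (x ∷ xs) = cong₂ _+_ (cong bit (P≗Q x)) (count-cong P≗Q xs)

count-map : ∀ {A B : Set} (P : B → Bool) (g : A → B) xs → count P (map g xs) ≡ count (P ∘ g) xs
count-map P g []       = refl
count-map P g (x ∷ xs) = cong (bit (P (g x)) +_) (count-map P g xs)

count-const : ∀ {A : Set} (b : Bool) (xs ys : List A) → length xs ≡ length ys →
  count (λ _ → b) xs ≡ count (λ _ → b) ys
count-const b []       []       _  = refl
count-const b (_ ∷ xs) (_ ∷ ys) eq = cong (bit b +_) (count-const b xs ys (ℕ.suc-injective eq))

-- Transfer of the finite facts to a large complete graph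

switch-distinct : ∀ {N} {a b c d} {m m′ : PerfectMatching N} → Switch a b c d m m′ → Distinct a b c d
switch-distinct s = a≢b , a≢c , a≢d , b≢c , b≢d , c≢d
  where open Switch s

-- The map `β` witnesses that the image of `v` is a union of edges of `m`, so these edges can be
-- exchanged for any matching of the k vertices without disturbing the rest.
module Graft {N k : ℕ} (v : Fin k → Fin N) (v-injective : ∀ {i j : Fin k} → v i ≡ v j → i ≡ j)
             (m : PerfectMatching N) (β : Fin k → Fin k) (closed : ∀ (i : Fin k) → m · v i ≡ v (β i)) where

  module _ (μ : Fin k → Fin k) where

    graftPartner : Fin N → Fin N
    graftPartner x with any? (λ i → v i ≟ x)
    ... | yes (i , _) = v (μ i)
    ... | no  _       = m · x

    graftPartner-in : ∀ i → graftPartner (v i) ≡ v (μ i)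
    graftPartner-in i with any? (λ j → v j ≟ v i)
    ... | yes (j , eq) = cong (v ∘ μ) (v-injective eq)
    ... | no  none     = contradiction (i , refl) none

    graftPartner-out : ∀ {x} → ¬ ∃ (λ i → v i ≡ x) → graftPartner x ≡ m · x
    graftPartner-out {x} out with any? (λ j → v j ≟ x)
    ... | yes some = contradiction some out
    ... | no  _    = refl

    module _ (valid : ∀ (i : Fin k) → μ (μ i) ≡ i × μ i ≢ i) where

      graft : PerfectMatching N
      graft = fromInvolution graftPartner involutive irreflexive′
        where
        involutive : ∀ x → graftPartner (graftPartner x) ≡ x
        involutive x with any? (λ i → v i ≟ x)
        ... | yes (i , refl) = trans (graftPartner-in (μ i)) (cong v (proj₁ (valid i)))
        ... | no  out = trans (graftPartner-out λ (i , eq) → out (β i , trans (sym (closed i))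
                          (·-swap m (sym eq)))) (·-involutive m x)
        irreflexive′ : ∀ x → graftPartner x ≢ x
        irreflexive′ x with any? (λ i → v i ≟ x)
        ... | yes (i , refl) = proj₂ (valid i) ∘ v-injective
        ... | no  _          = ·-irreflexive m x

module Local {N : ℕ} (m₀ : PerfectMatching N) (f : BooleanFunction N) (deg : DegreeAtMost 1 f) where

  ⟪_⟫ : PerfectMatching N → Bool
  ⟪_⟫ = Func.to f

  balance : ∀ {m₁ m₁′ m₂ m₂′} →
    (∀ i → (m₁ · i ≡ m₂ · i × m₁′ · i ≡ m₂′ · i) ⊎ (m₁ · i ≡ m₁′ · i × m₂ · i ≡ m₂′ · i)) →
    bit ⟪ m₁ ⟫ + bit ⟪ m₂′ ⟫ ≡ bit ⟪ m₁′ ⟫ + bit ⟪ m₂ ⟫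
  balance {m₁} {m₁′} {m₂} {m₂′} agree = trans (cong (bit ⟪ m₁ ⟫ +_) (sym (ℕ.+-identityʳ _)))
    (trans (count-balanced {ms = m₁ ∷ m₂′ ∷ []} {ms′ = m₁′ ∷ m₂ ∷ []} refl edges f deg)
           (cong (bit ⟪ m₁′ ⟫ +_) (ℕ.+-identityʳ _)))
    where
    edges : ∀ i j → count (λ m → has m i j) (m₁ ∷ m₂′ ∷ []) ≡ count (λ m → has m i j) (m₁′ ∷ m₂ ∷ [])
    edges i j rewrite has-does m₁ i j | has-does m₁′ i j | has-does m₂ i j | has-does m₂′ i j with agree i
    ... | inj₂ (eq , eq′) rewrite eq | eq′ = refl
    ... | inj₁ (eq , eq′) rewrite eq | eq′ =
      trans (cong (bit (does (m₂ · i ≟ j)) +_) (ℕ.+-identityʳ _))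
        (trans (ℕ.+-comm (bit (does (m₂ · i ≟ j))) _) (cong (bit (does (m₂′ · i ≟ j)) +_) (sym (ℕ.+-identityʳ _))))

  through : Fin N → Fin N → Fin N → Fin N → PerfectMatching N
  through a b c d = join c d (join a b m₀)

  ==-balanced : ∀ p p′ q q′ → bit p + bit q′ ≡ bit p′ + bit q → (p == p′) ≡ (q == q′)
  ==-balanced true  true  true  true  _ = refl
  ==-balanced true  true  false false _ = refl
  ==-balanced true  false true  false _ = refl
  ==-balanced true  false false true ()
  ==-balanced false true  false true  _ = refl
  ==-balanced false true  true  false ()
  ==-balanced false false true  true  _ = refl
  ==-balanced false false false false _ = refl

  through-ab : ∀ {a b c d} → Distinct a b c d → through a b c d · a ≡ b
  through-ab {a} {b} (a≢b , a≢c , a≢d , b≢c , b≢d , _) =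
    join-keeps (join a b m₀) a≢c a≢d b≢c b≢d (join-edge m₀ a≢b)

  through-cd : ∀ {a b c d} → Distinct a b c d → through a b c d · c ≡ d
  through-cd {a} {b} (_ , _ , _ , _ , _ , c≢d) = join-edge (join a b m₀) c≢d

  join-switch-at : ∀ {a b c d} (m : PerfectMatching N) → a ≢ c → b ≢ c → m · a ≡ b → m · c ≡ d → Switch a b c d m (join a c m)
  join-switch-at m a≢c b≢c refl refl = join-switch m a≢c b≢c

  through-switch : ∀ {a b c d} → Distinct a b c d →
    Switch a b c d (through a b c d) (join a c (through a b c d))
  through-switch {a} {b} {c} {d} dist@(_ , a≢c , _ , b≢c , _) =
    join-switch-at (through a b c d) a≢c b≢c
      (through-ab {a} {b} {c} {d} dist) (through-cd {a} {b} {c} {d} dist)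

  switch-invariant : ∀ {a b c d} {m₁ m₁′ m₂ m₂′ : PerfectMatching N} →
    Switch a b c d m₁ m₁′ → Switch a b c d m₂ m₂′ → (⟪ m₁ ⟫ == ⟪ m₁′ ⟫) ≡ (⟪ m₂ ⟫ == ⟪ m₂′ ⟫)
  switch-invariant {m₁ = m₁} {m₁′} {m₂} {m₂′} s₁ s₂ =
    ==-balanced ⟪ m₁ ⟫ ⟪ m₁′ ⟫ ⟪ m₂ ⟫ ⟪ m₂′ ⟫ (balance {m₁} {m₁′} {m₂} {m₂′} (switch-agree s₁ s₂))

  opaque

    -- Evaluated on one sample switch, which makes it a function of the four vertices alone;
    -- `S-switch` then removes the dependence on the sample.
    S : Rel (Fin N)
    S a b c d = ⟪ through a b c d ⟫ == ⟪ join a c (through a b c d) ⟫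

    S-switch : ∀ {a b c d} {m m′ : PerfectMatching N} → Switch a b c d m m′ → S a b c d ≡ (⟪ m ⟫ == ⟪ m′ ⟫)
    S-switch s = switch-invariant (through-switch (switch-distinct s)) s

  module Grafts {k t : ℕ} (μ : Vec (Vec (Fin k) k) (suc t)) (involutions : Involutions μ) (indexed : Indexed μ)
                (v : Fin k → Fin N) (v-injective : ∀ {i j : Fin k} → v i ≡ v j → i ≡ j)
                (m : PerfectMatching N) (β : Fin k → Fin k) (closed : ∀ (i : Fin k) → m · v i ≡ v (β i)) where

    open Graft v v-injective m β closed public

    local : Fin (suc t) → PerfectMatching N
    local n = graft (lookup (lookup μ n)) (involutions n)

    bits : Vec Bool (suc t)
    bits = tabulate (⟪_⟫ ∘ local)

    local-switch : ∀ {i j p q} → Distinct i j p q →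
      Switch (v i) (v j) (v p) (v q) (local (Table.index μ i j p q)) (local (Table.index μ i p j q))
    local-switch {i} {j} {p} {q} dist@(_ , _ , _ , j≢p , _)
      with ij , pq , ip , jq , rest ← indexed i j p q dist = record
      { b≢c  = j≢p ∘ v-injective
      ; ab   = trans (graftPartner-in ν i) (cong v ij)
      ; cd   = trans (graftPartner-in ν p) (cong v pq)
      ; ac   = trans (graftPartner-in ν′ i) (cong v ip)
      ; bd   = trans (graftPartner-in ν′ j) (cong v jq)
      ; rest = rest′ rest
      }
      where
      ν  = lookup (lookup μ (Table.index μ i j p q))
      ν′ = lookup (lookup μ (Table.index μ i p j q))
      rest′ : (∀ x → x ≢ i → x ≢ j → x ≢ p → x ≢ q → ν x ≡ ν′ x) →
        ∀ x → x ≢ v i → x ≢ v j → x ≢ v p → x ≢ v q → graftPartner ν x ≡ graftPartner ν′ x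
      rest′ h x x≢i x≢j x≢p x≢q with any? (λ l → v l ≟ x)
      ... | yes (l , refl) = cong v (h l (x≢i ∘ cong v) (x≢j ∘ cong v) (x≢p ∘ cong v) (x≢q ∘ cong v))
      ... | no  _          = refl

    -- The table knows f only on the grafted matchings. That suffices, since `S` can be read off any
    -- switch on the same vertices.
    rel-bits : ∀ {i j p q} → Distinct i j p q → Table.rel μ bits i j p q ≡ S (v i) (v j) (v p) (v q)
    rel-bits {i} {j} {p} {q} dist = trans
      (cong₂ _==_ (lookup∘tabulate (⟪_⟫ ∘ local) (Table.index μ i j p q))
                  (lookup∘tabulate (⟪_⟫ ∘ local) (Table.index μ i p j q)))
      (sym (S-switch (local-switch dist)))

  module _ {a b c d : Fin N} (dist : Distinct a b c d) where

    private
      vs : Vec (Fin N) 4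
      vs = a ∷ b ∷ c ∷ d ∷ []

      unique : Unique vs
      unique = let a≢b , a≢c , a≢d , b≢c , b≢d , c≢d = dist in
        (a≢b ∷ a≢c ∷ a≢d ∷ []) ∷ (b≢c ∷ b≢d ∷ []) ∷ (c≢d ∷ []) ∷ [] ∷ []

      M = through a b c d

      closed : ∀ i → M · lookup vs i ≡ lookup vs (lookup (lookup matchings₄ 0F) i)
      closed 0F = through-ab {a} {b} {c} {d} dist
      closed 1F = ·-swap M (closed 0F)
      closed 2F = through-cd {a} {b} {c} {d} dist
      closed 3F = ·-swap M (closed 2F)

    S-facts₄ : Holds facts₄ λ i j p q → S (lookup vs i) (lookup vs j) (lookup vs p) (lookup vs q)
    S-facts₄ = holds-cong rel-bits (facts₄-hold bits)
      where open Grafts matchings₄ involutions₄ indexed₄ (lookup vs) (lookup-injective unique _ _)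
                        M (lookup (lookup matchings₄ 0F)) closed

  module _ {a b c d e g : Fin N} (unique : Unique (a ∷ b ∷ c ∷ d ∷ e ∷ g ∷ [])) where

    private
      vs : Vec (Fin N) 6
      vs = a ∷ b ∷ c ∷ d ∷ e ∷ g ∷ []

      v : Fin 6 → Fin N
      v = lookup vs

      β : Fin 6 → Fin 6
      β = lookup (lookup matchings₆ 0F)

      M = join e g (through a b c d)

      apart : ∀ i j → i ≢ j → v i ≢ v j
      apart i j i≢j = i≢j ∘ lookup-injective unique i j

      dist : Distinct a b c d
      dist = apart 0F 1F (λ ()) , apart 0F 2F (λ ()) , apart 0F 3F (λ ()) ,
             apart 1F 2F (λ ()) , apart 1F 3F (λ ()) , apart 2F 3F (λ ())

      closed : ∀ i → M · v i ≡ v (β i)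
      closed 0F = join-keeps (through a b c d) (apart 0F 4F λ ()) (apart 0F 5F λ ()) (apart 1F 4F λ ()) (apart 1F 5F λ ())
        (through-ab {a} {b} {c} {d} dist)
      closed 1F = ·-swap M (closed 0F)
      closed 2F = join-keeps (through a b c d) (apart 2F 4F λ ()) (apart 2F 5F λ ()) (apart 3F 4F λ ()) (apart 3F 5F λ ())
        (through-cd {a} {b} {c} {d} dist)
      closed 3F = ·-swap M (closed 2F)
      closed 4F = join-edge (through a b c d) (apart 4F 5F λ ())
      closed 5F = ·-swap M (closed 4F)

      open Grafts matchings₆ involutions₆ indexed₆ v (lookup-injective unique _ _) M β closed

      edges : ∀ n x y → count (λ m → has m x y) (map local (factorization 0F))
                      ≡ count (λ m → has m x y) (map local (factorization n))
      edges n x y = trans (count-map (λ m → has m x y) local (factorization 0F))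
        (trans (counts (any? λ i → v i ≟ x) (any? λ j → v j ≟ y)) (sym (count-map (λ m → has m x y) local (factorization n))))
        where
        ν : Fin 15 → Fin 6 → Fin 6
        ν t = lookup (lookup matchings₆ t)

        same : ∀ {P : Fin 15 → Bool} → (∀ t → has (local t) x y ≡ P t) →
          count P (factorization 0F) ≡ count P (factorization n) →
          count (λ t → has (local t) x y) (factorization 0F) ≡ count (λ t → has (local t) x y) (factorization n)
        same eq h = trans (count-cong eq (factorization 0F)) (trans h (sym (count-cong eq (factorization n))))

        const : ∀ b → count (λ _ → b) (factorization 0F) ≡ count (λ _ → b) (factorization n)
        const b = count-const b (factorization 0F) (factorization n) (factorization-length n)

        does-v : ∀ i j → does (v i ≟ v j) ≡ does (i ≟ j)
        does-v i j with i ≟ j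
        ... | yes refl = dec-true (v i ≟ v i) refl
        ... | no  i≢j  = dec-false (v i ≟ v j) (apart i j i≢j)

        counts : Dec (∃ λ i → v i ≡ x) → Dec (∃ λ j → v j ≡ y) →
          count (λ t → has (local t) x y) (factorization 0F) ≡ count (λ t → has (local t) x y) (factorization n)
        counts (yes (i , refl)) (yes (j , refl)) = same
          (λ t → trans (cong (λ z → does (z ≟ v j)) (graftPartner-in (ν t) i)) (does-v (ν t i) j))
          (factorization-edges n i j)
        counts (yes (i , refl)) (no out) = same
          (λ t → trans (cong (λ z → does (z ≟ y)) (graftPartner-in (ν t) i))
                       (dec-false (v (ν t i) ≟ y) λ eq → out (ν t i , eq)))
          (const false)
        counts (no out) _ = same
          (λ t → cong (λ z → does (z ≟ y)) (graftPartner-out (ν t) out))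
          (const _)

      ones≡ : ∀ n → count (lookup bits) (factorization 0F) ≡ count (lookup bits) (factorization n)
      ones≡ n = trans (bits-count (factorization 0F)) (trans
        (count-balanced {ms = map local (factorization 0F)} {ms′ = map local (factorization n)}
          (trans (length-map local (factorization 0F))
            (trans (factorization-length n) (sym (length-map local (factorization n))))) (edges n) f deg)
        (sym (bits-count (factorization n))))
        where
        bits-count : ∀ ts → count (lookup bits) ts ≡ count ⟪_⟫ (map local ts)
        bits-count ts = trans (count-cong (lookup∘tabulate (⟪_⟫ ∘ local)) ts) (sym (count-map ⟪_⟫ local ts))

      bits-regular : regular bits ≡ true
      bits-regular = cong₂ _∧_ (w 1F) (cong₂ _∧_ (w 2F) (cong₂ _∧_ (w 3F) (cong₂ _∧_ (w 4F) (w 5F))))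
        where
        w : ∀ n → (count (lookup bits) (factorization 0F) ≡ᵇ count (lookup bits) (factorization n)) ≡ true
        w n = dec-true (_ ℕ.≟ _) (ones≡ n)

    S-facts₆ : Holds facts₆ λ i j p q → S (v i) (v j) (v p) (v q)
    S-facts₆ = holds-cong rel-bits (facts₆-hold bits bits-regular)

-- From local changes to global dependence

∧-intro : ∀ {p q} → p ≡ true → q ≡ true → p ∧ q ≡ true
∧-intro refl refl = refl

∧-split₃ : ∀ p q r → p ∧ q ∧ r ≡ true → p ≡ true × q ≡ true × r ≡ true
∧-split₃ true true true _ = refl , refl , refl

∧-split₄ : ∀ p q r s → p ∧ q ∧ r ∧ s ≡ true → p ≡ true × q ≡ true × r ≡ true × s ≡ true
∧-split₄ true q r s h = refl , ∧-split₃ q r s h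

==⇒≡ : ∀ {p q} → (p == q) ≡ true → p ≡ q
==⇒≡ {true}  {true}  _ = refl
==⇒≡ {false} {false} _ = refl

≡⇒== : ∀ {p q} → p ≡ q → (p == q) ≡ true
≡⇒== {true}  refl = refl
≡⇒== {false} refl = refl

true≢false : ∀ {p} → p ≡ true → p ≡ false → ⊥
true≢false refl ()

-- The removed and added edges xy, zw, xz, yw form a 4-cycle with opposite corners x, w and y, z. If
-- the switch changes f, each pair of opposite corners has a member in U, so some edge of the cycle
-- lies inside U.
cut-split : ∀ p q r s → cut p q r s ≡ false → (p ≡ true ⊎ s ≡ true) × (q ≡ true ⊎ r ≡ true)
cut-split true  true  r     s     _ = inj₁ refl , inj₁ refl
cut-split true  false true  s     _ = inj₁ refl , inj₂ refl
cut-split false true  r     true  _ = inj₂ refl , inj₁ refl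
cut-split false false true  true  _ = inj₂ refl , inj₂ refl
cut-split true  false false true  ()
cut-split true  false false false ()
cut-split false true  true  false ()
cut-split false true  false false ()
cut-split false false true  false ()
cut-split false false false true  ()
cut-split false false false false ()

cut-flat : ∀ {p q r s} → p ≡ true → q ≡ true → r ≡ false → s ≡ false → cut p q r s ≡ false
cut-flat refl refl refl refl = refl

cut-not : ∀ p q r s → cut (not p) (not q) (not r) (not s) ≡ cut p q r s
cut-not p q r s = cong₂ _∨_ (==-not p s) (==-not q r)
  where
  ==-not : ∀ x y → (not x == not y) ≡ (x == y)
  ==-not true  true  = refl
  ==-not true  false = refl
  ==-not false true  = refl
  ==-not false false = refl

module _ {N : ℕ} (m m′ : PerfectMatching N) {x : Fin N} (x-differs : m · x ≢ m′ · x) where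

  -- The switch that gives x its partner in m′ touches only vertices of disagreement: agreement at
  -- any of the four would, by involutivity, force agreement at x.
  disagree : ∀ {y} → m · y ≡ m′ · y → y ≢ x × y ≢ m · x × y ≢ m′ · x × y ≢ m · (m′ · x)
  disagree {y} agree = (λ { refl → x-differs agree })
    , (λ { refl → x-differs (sym (·-swap m′ (trans (sym agree) (·-involutive m x)))) })
    , (λ { refl → x-differs (·-swap m (trans agree (·-involutive m′ x))) })
    , (λ { refl → x-differs (·-swap m (trans
        (sym (·-swap m′ (trans (sym agree) (·-involutive m (m′ · x))))) (·-involutive m′ x))) })

  join-agree : ∀ {y} → m · y ≡ m′ · y → join x (m′ · x) m · y ≡ m′ · y
  join-agree agree with y≢x , y≢mx , y≢z , y≢mz ← disagree agree =
    trans (join-other m y≢x y≢mx y≢z y≢mz) agree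

  join-towards : Switch x (m · x) (m′ · x) (m · (m′ · x)) m (join x (m′ · x) m)
  join-towards = join-switch m (≢-sym (·-irreflexive m′ x)) x-differs

module Global {N : ℕ} (m₀ : PerfectMatching N) (f : BooleanFunction N) (deg : DegreeAtMost 1 f) where

  open Local m₀ f deg

  S-equal : ∀ {a b c d} {m m′ : PerfectMatching N} → Switch a b c d m m′ → S a b c d ≡ true → ⟪ m ⟫ ≡ ⟪ m′ ⟫
  S-equal s h = ==⇒≡ (trans (sym (S-switch s)) h)

  -- Moving m to m′ one vertex at a time keeps agreement on P.
  module Walk (m′ : PerfectMatching N) (P : Fin N → Set)
              (step : ∀ (m : PerfectMatching N) (x : Fin N) → (∀ (y : Fin N) → P y → m · y ≡ m′ · y) → m · x ≢ m′ · x →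
                      S x (m · x) (m′ · x) (m · (m′ · x)) ≡ true) where

    walk : ∀ xs m → (∀ y → P y → m · y ≡ m′ · y) → ∃ λ m″ → ⟪ m ⟫ ≡ ⟪ m″ ⟫ ×
      (∀ y → m · y ≡ m′ · y → m″ · y ≡ m′ · y) × (∀ y → y ∈ xs → m″ · y ≡ m′ · y)
    walk []       m agree = m , refl , (λ _ eq → eq) , λ _ ()
    walk (x ∷ xs) m agree with m · x ≟ m′ · x
    ... | yes eq with m″ , same , keep , new ← walk xs m agree =
      m″ , same , keep , λ { _ (here refl) → keep x eq ; y (there y∈xs) → new y y∈xs }
    ... | no neq with m″ , same , keep , new ← walk xs (join x (m′ · x) m) (λ y Py → join-agree m m′ neq (agree y Py)) =
      m″ , trans (S-equal (join-towards m m′ neq) (step m x agree neq)) same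
         , (λ y eq → keep y (join-agree m m′ neq eq))
         , λ { _ (here refl) → keep x (join-edge m (≢-sym (·-irreflexive m′ x))) ; y (there y∈xs) → new y y∈xs }

    walk-equal : ∀ m → (∀ y → P y → m · y ≡ m′ · y) → ⟪ m ⟫ ≡ ⟪ m′ ⟫
    walk-equal m agree with m″ , same , _ , new ← walk (allFin N) m agree =
      trans same (respects f λ y → new y (∈-allFin y))

  constant : (∀ {x y z w} → Distinct x y z w → S x y z w ≡ true) → IsConstant f
  constant still = ⟪ m₀ ⟫ , λ m → walk-equal m₀ m
    where
    walk-equal : ∀ m m′ → ⟪ m′ ⟫ ≡ ⟪ m ⟫
    walk-equal m m′ = Walk.walk-equal m (λ _ → ⊥)
      (λ k x _ neq → still (switch-distinct (join-towards k m neq))) m′ λ _ ()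

  dependsOnPartner : ∀ a →
    (∀ {x y z w} → x ≢ a → y ≢ a → z ≢ a → w ≢ a → Distinct x y z w → S x y z w ≡ true) →
    DependsOnlyOn f (partner a)
  dependsOnPartner a still m m′ eq = Walk.walk-equal m′ (_≡ a)
    (λ k x agree neq → let a≢x , a≢y , a≢z , a≢w = disagree k m′ neq (agree a refl) in
      still (≢-sym a≢x) (≢-sym a≢y) (≢-sym a≢z) (≢-sym a≢w)
        (switch-distinct (join-towards k m′ neq)))
    m λ { _ refl → eq }

  -- Functions that change like the number of edges inside a triangle

  CutOf : (Fin N → Bool) → Set
  CutOf τ = ∀ {x y z w} → Distinct x y z w → S x y z w ≡ cut (τ x) (τ y) (τ z) (τ w)

  module Triangle {τ : Fin N → Bool} (cutS : CutOf τ) (a b k : Fin N)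
                  (τa : τ a ≡ true) (τb : τ b ≡ true) (τk : τ k ≡ true)
                  (a≢b : a ≢ b) (b≢k : b ≢ k) (k≢a : k ≢ a)
                  (only : ∀ (x : Fin N) → τ x ≡ true → x ≡ a ⊎ x ≡ b ⊎ x ≡ k) where

    -- The switches of the walk avoid a and b, so k is the only vertex of U that they can touch,
    -- whereas a change of f needs two.
    common-edge : ∀ m m′ → m · a ≡ b → m′ · a ≡ b → ⟪ m ⟫ ≡ ⟪ m′ ⟫
    common-edge m m′ ma≡b m′a≡b = Walk.walk-equal m′ (λ y → y ≡ a ⊎ y ≡ b) step m
      λ { _ (inj₁ refl) → trans ma≡b (sym m′a≡b)
        ; _ (inj₂ refl) → trans (·-swap m ma≡b) (sym (·-swap m′ m′a≡b)) }
      where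
      step : ∀ m x → (∀ y → y ≡ a ⊎ y ≡ b → m · y ≡ m′ · y) → m · x ≢ m′ · x →
             S x (m · x) (m′ · x) (m · (m′ · x)) ≡ true
      step m x agree neq
        with dist@(x≢y , x≢z , x≢w , y≢z , y≢w , z≢w) ← switch-distinct (join-towards m m′ neq)
           | a≢x , a≢y , a≢z , a≢w ← disagree m m′ neq (agree a (inj₁ refl))
           | b≢x , b≢y , b≢z , b≢w ← disagree m m′ neq (agree b (inj₂ refl)) =
        trans (cutS dist) (Bool.¬-not moved)
        where
        is-k : ∀ {u} → a ≢ u → b ≢ u → τ u ≡ true → u ≡ k
        is-k a≢u b≢u τu with only _ τu
        ... | inj₁ u≡a        = contradiction (sym u≡a) a≢u
        ... | inj₂ (inj₁ u≡b) = contradiction (sym u≡b) b≢u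
        ... | inj₂ (inj₂ u≡k) = u≡k
        moved : cut (τ x) (τ (m · x)) (τ (m′ · x)) (τ (m · (m′ · x))) ≢ false
        moved eq with cut-split (τ x) _ _ _ eq
        ... | inj₁ τx , inj₁ τy = x≢y (trans (is-k a≢x b≢x τx) (sym (is-k a≢y b≢y τy)))
        ... | inj₁ τx , inj₂ τz = x≢z (trans (is-k a≢x b≢x τx) (sym (is-k a≢z b≢z τz)))
        ... | inj₂ τw , inj₁ τy = y≢w (trans (is-k a≢y b≢y τy) (sym (is-k a≢w b≢w τw)))
        ... | inj₂ τw , inj₂ τz = z≢w (trans (is-k a≢z b≢z τz) (sym (is-k a≢w b≢w τw)))

    TriangleFree : PerfectMatching N → Set
    TriangleFree m = ∀ y → τ y ≡ true → τ (m · y) ≡ true → ⊥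

    -- By `cut-split` a change of f puts an edge of the 4-cycle inside U. Three of the edges belong
    -- to m or m′, which have none there. The fourth joins m x to m (m′ x); the last hypothesis
    -- excludes it, because m x is outside U when x is inside, and m and m′ disagree at m x.
    triangleFree-step : ∀ {m m′ x} → TriangleFree m → TriangleFree m′ → m · x ≢ m′ · x →
      (τ x ≡ true ⊎ (∀ y → τ y ≡ true → m · y ≡ m′ · y)) →
      S x (m · x) (m′ · x) (m · (m′ · x)) ≡ true
    triangleFree-step {m} {m′} {x} free free′ neq agree =
      trans (cutS (switch-distinct (join-towards m m′ neq))) (Bool.¬-not moved)
      where
      moved : cut (τ x) (τ (m · x)) (τ (m′ · x)) (τ (m · (m′ · x))) ≢ false
      moved eq with cut-split (τ x) _ _ _ eq
      ... | inj₁ τx , inj₁ τy = free x τx τy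
      ... | inj₁ τx , inj₂ τz = free′ x τx τz
      ... | inj₂ τw , inj₂ τz = free (m′ · x) τz τw
      ... | inj₂ τw , inj₁ τy = case agree of λ
        { (inj₁ τx)  → free x τx τy
        ; (inj₂ all) → proj₁ (proj₂ (disagree m m′ neq (all (m · x) τy))) refl }

    -- For x in U, the new edge at x comes from m′, and the other new edge ends in the old partner
    -- of x, which lies outside U.
    triangleFree-join : ∀ {m m′ x} → TriangleFree m → TriangleFree m′ → m · x ≢ m′ · x → τ x ≡ true →
      TriangleFree (join x (m′ · x) m)
    triangleFree-join {m} {m′} {x} free free′ neq τx = go
      where
      s = join-towards m m′ neq
      open Switch s
      M = join x (m′ · x) m
      go : TriangleFree M
      go y τy τMy with y ≟ x | y ≟ m · x | y ≟ m′ · x | y ≟ m · (m′ · x)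
      ... | yes refl | _ | _ | _ = free′ x τx (subst (λ u → τ u ≡ true) ac τMy)
      ... | _ | yes refl | _ | _ = free x τx τy
      ... | _ | _ | yes refl | _ = free′ x τx τy
      ... | _ | _ | _ | yes refl = free x τx (subst (λ u → τ u ≡ true) (·-swap M bd) τMy)
      ... | no y≢x | no y≢mx | no y≢z | no y≢w =
        free y τy (subst (λ u → τ u ≡ true) (sym (rest y y≢x y≢mx y≢z y≢w)) τMy)

    triangleFree-align : ∀ {m m′} x → τ x ≡ true → TriangleFree m → TriangleFree m′ →
      ∃ λ m″ → ⟪ m ⟫ ≡ ⟪ m″ ⟫ × TriangleFree m″ × m″ · x ≡ m′ · x × (∀ y → m · y ≡ m′ · y → m″ · y ≡ m′ · y)
    triangleFree-align {m} {m′} x τx free free′ with m · x ≟ m′ · x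
    ... | yes eq  = m , refl , free , eq , λ _ same → same
    ... | no neq = join x (m′ · x) m
      , S-equal (join-towards m m′ neq) (triangleFree-step {m} {m′} free free′ neq (inj₁ τx))
      , triangleFree-join {m} {m′} free free′ neq τx
      , join-edge m (≢-sym (·-irreflexive m′ x))
      , λ _ → join-agree m m′ neq

    -- A switch at a vertex outside U may create an edge inside U, so the order of the walk matters:
    -- the three vertices of U are aligned first and stay fixed afterwards.
    triangleFree-equal : ∀ m m′ → TriangleFree m → TriangleFree m′ → ⟪ m ⟫ ≡ ⟪ m′ ⟫
    triangleFree-equal m m′ free free′
      with m₁ , eq₁ , free₁ , ata , _     ← triangleFree-align {m} {m′} a τa free free′
      with m₂ , eq₂ , free₂ , atb , keep₂ ← triangleFree-align {m₁} {m′} b τb free₁ free′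
      with m₃ , eq₃ , free₃ , atk , keep₃ ← triangleFree-align {m₂} {m′} k τk free₂ free′ =
      trans eq₁ (trans eq₂ (trans eq₃ (Walk.walk-equal m′ (λ y → y ≡ a ⊎ y ≡ b ⊎ y ≡ k) step′ m₃ agree₃)))
      where
      agree₃ : ∀ y → y ≡ a ⊎ y ≡ b ⊎ y ≡ k → m₃ · y ≡ m′ · y
      agree₃ _ (inj₁ refl)        = keep₃ a (keep₂ a ata)
      agree₃ _ (inj₂ (inj₁ refl)) = keep₃ b atb
      agree₃ _ (inj₂ (inj₂ refl)) = atk

      free-agree : ∀ {m} → (∀ y → y ≡ a ⊎ y ≡ b ⊎ y ≡ k → m · y ≡ m′ · y) → TriangleFree m
      free-agree agree y τy τmy = free′ y τy (subst (λ u → τ u ≡ true) (agree y (only y τy)) τmy)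

      step′ : ∀ m x → (∀ y → y ≡ a ⊎ y ≡ b ⊎ y ≡ k → m · y ≡ m′ · y) → m · x ≢ m′ · x →
        S x (m · x) (m′ · x) (m · (m′ · x)) ≡ true
      step′ m x agree neq = triangleFree-step {m} {m′} (free-agree {m} agree) free′ neq
        (inj₂ λ y τy → agree y (only y τy))

  -- One switch at b replaces ab by bk. It leaves f unchanged because the opposite corners a and k
  -- are both in U.
  rotate : ∀ {τ} (cutS : CutOf τ) a b k → τ a ≡ true → τ b ≡ true → τ k ≡ true →
    a ≢ b → b ≢ k → k ≢ a → (∀ x → τ x ≡ true → x ≡ a ⊎ x ≡ b ⊎ x ≡ k) →
    ∀ m m′ → m · a ≡ b → m′ · b ≡ k → ⟪ m ⟫ ≡ ⟪ m′ ⟫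
  rotate {τ} cutS a b k τa τb τk a≢b b≢k k≢a only m m′ ma≡b m′b≡k =
    trans (S-equal s (trans (cutS (switch-distinct s)) still))
      (Triangle.common-edge cutS b k a τb τk τa b≢k k≢a a≢b only′ (join b k m) m′ (join-edge m b≢k) m′b≡k)
    where
    s : Switch b a k (m · k) m (join b k m)
    s = join-switch-at m b≢k (≢-sym k≢a) (·-swap m ma≡b) refl
    still : cut (τ b) (τ a) (τ k) (τ (m · k)) ≡ true
    still rewrite τb | τa | τk = Bool.∨-zeroʳ (true == τ (m · k))
    only′ : ∀ x → τ x ≡ true → x ≡ b ⊎ x ≡ k ⊎ x ≡ a
    only′ x τx with only x τx
    ... | inj₁ x≡a        = inj₂ (inj₂ x≡a)
    ... | inj₂ (inj₁ x≡b) = inj₁ x≡b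
    ... | inj₂ (inj₂ x≡k) = inj₂ (inj₁ x≡k)

  module _ {τ : Fin N → Bool} (cutS : CutOf τ) (a b k : Fin N) (τa : τ a ≡ true) (τb : τ b ≡ true) (τk : τ k ≡ true)
           (a≢b : a ≢ b) (b≢k : b ≢ k) (k≢a : k ≢ a)
           (only : ∀ (x : Fin N) → τ x ≡ true → x ≡ a ⊎ x ≡ b ⊎ x ≡ k) where

    private
      only₁ : ∀ x → τ x ≡ true → x ≡ b ⊎ x ≡ k ⊎ x ≡ a
      only₁ x τx with only x τx
      ... | inj₁ x≡a        = inj₂ (inj₂ x≡a)
      ... | inj₂ (inj₁ x≡b) = inj₁ x≡b
      ... | inj₂ (inj₂ x≡k) = inj₂ (inj₁ x≡k)

      only₂ : ∀ x → τ x ≡ true → x ≡ k ⊎ x ≡ a ⊎ x ≡ b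
      only₂ x τx with only₁ x τx
      ... | inj₁ x≡b        = inj₂ (inj₂ x≡b)
      ... | inj₂ (inj₁ x≡k) = inj₁ x≡k
      ... | inj₂ (inj₂ x≡a) = inj₂ (inj₁ x≡a)

      module AB = Triangle cutS a b k τa τb τk a≢b b≢k k≢a only
      module BK = Triangle cutS b k a τb τk τa b≢k k≢a a≢b only₁
      module KA = Triangle cutS k a b τk τa τb k≢a a≢b b≢k only₂

    Meets : PerfectMatching N → Set
    Meets m = m · a ≡ b ⊎ m · b ≡ k ⊎ m · k ≡ a

    meets-equal : ∀ m m′ → Meets m → Meets m′ → ⟪ m ⟫ ≡ ⟪ m′ ⟫
    meets-equal m m′ (inj₁ p)        (inj₁ q)        = AB.common-edge m m′ p q
    meets-equal m m′ (inj₁ p)        (inj₂ (inj₁ q)) = rotate cutS a b k τa τb τk a≢b b≢k k≢a only m m′ p q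
    meets-equal m m′ (inj₁ p)        (inj₂ (inj₂ q)) = sym (rotate cutS k a b τk τa τb k≢a a≢b b≢k only₂ m′ m q p)
    meets-equal m m′ (inj₂ (inj₁ p)) (inj₁ q)        = sym (rotate cutS a b k τa τb τk a≢b b≢k k≢a only m′ m q p)
    meets-equal m m′ (inj₂ (inj₁ p)) (inj₂ (inj₁ q)) = BK.common-edge m m′ p q
    meets-equal m m′ (inj₂ (inj₁ p)) (inj₂ (inj₂ q)) = rotate cutS b k a τb τk τa b≢k k≢a a≢b only₁ m m′ p q
    meets-equal m m′ (inj₂ (inj₂ p)) (inj₁ q)        = rotate cutS k a b τk τa τb k≢a a≢b b≢k only₂ m m′ p q
    meets-equal m m′ (inj₂ (inj₂ p)) (inj₂ (inj₁ q)) = sym (rotate cutS b k a τb τk τa b≢k k≢a a≢b only₁ m′ m q p)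
    meets-equal m m′ (inj₂ (inj₂ p)) (inj₂ (inj₂ q)) = KA.common-edge m m′ p q

    meets : ∀ m → meetsTriangle a b k m ≡ true → Meets m
    meets m h with has m a b in ab | has m b k in bk | has m k a in ka
    ... | true  | _     | _    = inj₁ (partner-unique m ab)
    ... | false | true  | _    = inj₂ (inj₁ (partner-unique m bk))
    ... | false | false | true = inj₂ (inj₂ (partner-unique m ka))

    misses : ∀ m → meetsTriangle a b k m ≡ false → AB.TriangleFree m
    misses m h y τy τmy = contradiction (trans (sym (edge-in (only y τy) (only (m · y) τmy) (has-partner m y))) h) λ ()
      where
      edge-in : ∀ {u w} → u ≡ a ⊎ u ≡ b ⊎ u ≡ k → w ≡ a ⊎ w ≡ b ⊎ w ≡ k → has m u w ≡ true →
                meetsTriangle a b k m ≡ true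
      edge-in (inj₁ refl)        (inj₁ refl)        e = contradiction (partner-unique m e) (·-irreflexive m a)
      edge-in (inj₁ refl)        (inj₂ (inj₁ refl)) e rewrite e = refl
      edge-in (inj₁ refl)        (inj₂ (inj₂ refl)) e rewrite symmetric m k a | e =
        trans (cong (has m a b ∨_) (Bool.∨-zeroʳ _)) (Bool.∨-zeroʳ _)
      edge-in (inj₂ (inj₁ refl)) (inj₁ refl)        e rewrite symmetric m a b | e = refl
      edge-in (inj₂ (inj₁ refl)) (inj₂ (inj₁ refl)) e = contradiction (partner-unique m e) (·-irreflexive m b)
      edge-in (inj₂ (inj₁ refl)) (inj₂ (inj₂ refl)) e rewrite e = Bool.∨-zeroʳ _
      edge-in (inj₂ (inj₂ refl)) (inj₁ refl)        e rewrite e =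
        trans (cong (has m a b ∨_) (Bool.∨-zeroʳ _)) (Bool.∨-zeroʳ _)
      edge-in (inj₂ (inj₂ refl)) (inj₂ (inj₁ refl)) e rewrite symmetric m b k | e = Bool.∨-zeroʳ _
      edge-in (inj₂ (inj₂ refl)) (inj₂ (inj₂ refl)) e = contradiction (partner-unique m e) (·-irreflexive m k)

    dependsOnTriangle : DependsOnTriangle f
    dependsOnTriangle = a , b , k , a≢b , b≢k , k≢a , depends
      where
      depends : DependsOnlyOn f (meetsTriangle a b k)
      depends m m′ eq with meetsTriangle a b k m in h
      ... | true  = meets-equal m m′ (meets m h) (meets m′ (sym eq))
      ... | false = AB.triangleFree-equal m m′ (misses m h) (misses m′ (sym eq))

  -- The finite facts restated for arbitrary vertices

  module _ (τ : Fin N → Bool) {a b c d : Fin N} (dist : Distinct a b c d) (h : fit S τ a b c d ≡ true) where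

    private
      swaps : fit S τ b a c d ≡ true × fit S τ a c b d ≡ true × fit S τ a b d c ≡ true
      swaps =
        ∧-split₃ (fit S τ b a c d) (fit S τ a c b d) (fit S τ a b d c)
          (mp {fit S τ a b c d} {fit S τ b a c d ∧ fit S τ a c b d ∧ fit S τ a b d c}
            (swap-holds (λ i j p q → S (v i) (v j) (v p) (v q)) (S-facts₄ dist)
              (τ a ∷ τ b ∷ τ c ∷ τ d ∷ [])) h)
        where v = lookup (a ∷ b ∷ c ∷ d ∷ [])

    swap₁ : fit S τ b a c d ≡ true
    swap₁ = proj₁ swaps

    swap₂ : fit S τ a c b d ≡ true
    swap₂ = proj₁ (proj₂ swaps)

    swap₃ : fit S τ a b d c ≡ true
    swap₃ = proj₂ (proj₂ swaps)

  orient : ∀ {a b c d} → Distinct a b c d → S a b c d ≡ false →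
    odd S a b c d ≡ true ⊎ odd S a c b d ≡ true
  orient {a} {b} {c} {d} dist h = ∨-split
    (mp {not (S a b c d)} {odd S a b c d ∨ odd S a c b d}
      (orient-holds (λ i j p q → S (v i) (v j) (v p) (v q)) (S-facts₄ dist))
      (cong not h))
    where
    v = lookup (a ∷ b ∷ c ∷ d ∷ [])
    ∨-split : ∀ {p q} → p ∨ q ≡ true → p ≡ true ⊎ q ≡ true
    ∨-split {true}  _ = inj₁ refl
    ∨-split {false} h = inj₂ h

  Off : Fin N → Fin N → Fin N → Fin N → Fin N → Set
  Off a b c d e = e ≢ a × e ≢ b × e ≢ c × e ≢ d

  off? : ∀ a b c d e → Dec (Off a b c d e)
  off? a b c d e = ¬? (e ≟ a) ×-dec ¬? (e ≟ b) ×-dec ¬? (e ≟ c) ×-dec ¬? (e ≟ d)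

  unique₆ : ∀ {a b c d e g} → Distinct a b c d → Off a b c d e → Off a b c d g → e ≢ g →
    Unique (a ∷ b ∷ c ∷ d ∷ e ∷ g ∷ [])
  unique₆ (a≢b , a≢c , a≢d , b≢c , b≢d , c≢d) (e≢a , e≢b , e≢c , e≢d) (g≢a , g≢b , g≢c , g≢d) e≢g =
    (a≢b ∷ a≢c ∷ a≢d ∷ ≢-sym e≢a ∷ ≢-sym g≢a ∷ []) ∷ (b≢c ∷ b≢d ∷ ≢-sym e≢b ∷ ≢-sym g≢b ∷ []) ∷
    (c≢d ∷ ≢-sym e≢c ∷ ≢-sym g≢c ∷ []) ∷ (≢-sym e≢d ∷ ≢-sym g≢d ∷ []) ∷ (e≢g ∷ []) ∷ [] ∷ []

  -- A matching containing ab and cd pairs e with a vertex outside all five.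
  sixth : ∀ {a b c d e} → Distinct a b c d → Off a b c d e → ∃ λ g → Off a b c d g × e ≢ g
  sixth {a} {b} {c} {d} {e} dist (e≢a , e≢b , e≢c , e≢d) =
    m · e , (e≢b ∘ flip ab , e≢a ∘ flip (·-swap m ab) , e≢d ∘ flip cd , e≢c ∘ flip (·-swap m cd))
          , ≢-sym (·-irreflexive m e)
    where
    m = through a b c d
    open Switch (through-switch dist) using (ab; cd)
    flip : ∀ {x y} → m · x ≡ y → m · e ≡ x → e ≡ y
    flip xy ex = trans (sym (·-swap m ex)) xy

  module _ {a b c d e g : Fin N} (dist : Distinct a b c d) (e-off : Off a b c d e) (g-off : Off a b c d g) (e≢g : e ≢ g) where

    private
      v : Fin 6 → Fin N
      v = lookup (a ∷ b ∷ c ∷ d ∷ e ∷ g ∷ [])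

      s : Rel (Fin 6)
      s i j p q = S (v i) (v j) (v p) (v q)

      facts : Holds facts₆ s
      facts = S-facts₆ (unique₆ dist e-off g-off e≢g)

    inactive-pair : odd S a b c d ≡ true → inactive S b c d e ≡ true → inactive S b c d g ≡ true → inactive S b c e g ≡ true
    inactive-pair o i j = mp {inactive S b c d g} {inactive S b c e g}
      (mp {inactive S b c d e} {inactive S b c d g ⇒ inactive S b c e g}
        (mp {odd S a b c d} {inactive S b c d e ⇒ inactive S b c d g ⇒ inactive S b c e g} (pairFact-holds s facts) o) i) j

    inactive-spread : odd S a b c d ≡ true → inactive S b c d g ≡ true → inactive S a c d g ≡ false → inactive S b c d e ≡ true
    inactive-spread o i j = mp {not (inactive S a c d g)} {inactive S b c d e}
      (mp {inactive S b c d g} {not (inactive S a c d g) ⇒ inactive S b c d e}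
        (mp {odd S a b c d} {inactive S b c d g ⇒ not (inactive S a c d g) ⇒ inactive S b c d e} (spreadFact-holds s facts) o) i)
      (cong not j)

    types-fit : odd S a b c d ≡ true →
      inactive S b c d e ≡ inactive S a c d e → inactive S d a b e ≡ inactive S c a b e →
      inactive S b c d g ≡ inactive S a c d g → inactive S d a b g ≡ inactive S c a b g →
      not (inactive S b c d e == inactive S d a b e) ≡ true
      × fitAs S false false true (inactive S d a b e) c d a e ≡ true
      × fitAs S false false true (inactive S d a b e) c d b e ≡ true
      × fitAs S false false (inactive S d a b e) (inactive S d a b g) c d e g ≡ true
    types-fit o h i j k = ∧-split₄ W X Y Z (mp {D₁} {W ∧ X ∧ Y ∧ Z}
      (mp {C₁} {D₁ ⇒ W ∧ X ∧ Y ∧ Z}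
        (mp {B₁} {C₁ ⇒ D₁ ⇒ W ∧ X ∧ Y ∧ Z}
          (mp {A₁} {B₁ ⇒ C₁ ⇒ D₁ ⇒ W ∧ X ∧ Y ∧ Z}
            (mp {odd S a b c d} (typesFact-holds s facts) o) (≡⇒== h)) (≡⇒== i)) (≡⇒== j)) (≡⇒== k))
      where
      A₁ = inactive S b c d e == inactive S a c d e
      B₁ = inactive S d a b e == inactive S c a b e
      C₁ = inactive S b c d g == inactive S a c d g
      D₁ = inactive S d a b g == inactive S c a b g
      W  = not (inactive S b c d e == inactive S d a b e)
      X  = fitAs S false false true (inactive S d a b e) c d a e
      Y  = fitAs S false false true (inactive S d a b e) c d b e
      Z  = fitAs S false false (inactive S d a b e) (inactive S d a b g) c d e g

    fit-propagate : ∀ τ → fit S τ a b c d ≡ true → fit S τ a b c e ≡ true → fit S τ a b d e ≡ true →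
      (fit S τ a c d e ∧ fit S τ b c d e) ≡ true
    fit-propagate τ h i j = mp {fit S τ a b d e} {X}
      (mp {fit S τ a b c e} {fit S τ a b d e ⇒ X}
        (mp {fit S τ a b c d} {fit S τ a b c e ⇒ fit S τ a b d e ⇒ X}
          (propagateFact-holds s facts (τ a ∷ τ b ∷ τ c ∷ τ d ∷ τ e ∷ τ g ∷ [])) h) i) j
      where X = fit S τ a c d e ∧ fit S τ b c d e

  module _ {a b c d e : Fin N} (dist : Distinct a b c d) (e-off : Off a b c d e) (τ : Fin N → Bool)
           (h : fit S τ a b c d ≡ true) (i : fit S τ a b c e ≡ true) (j : fit S τ a b d e ≡ true) where

    fit-acde : fit S τ a c d e ≡ true
    fit-acde with g , g-off , e≢g ← sixth dist e-off =
      ∧-left {fit S τ a c d e} {fit S τ b c d e} (fit-propagate dist e-off g-off e≢g τ h i j)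

    fit-bcde : fit S τ b c d e ≡ true
    fit-bcde with g , g-off , e≢g ← sixth dist e-off =
      ∧-right {fit S τ a c d e} {fit S τ b c d e} (fit-propagate dist e-off g-off e≢g τ h i j)

  fit-relabel : ∀ τ {p q r t x y z w} → τ x ≡ p → τ y ≡ q → τ z ≡ r → τ w ≡ t →
    fitAs S p q r t x y z w ≡ true → fit S τ x y z w ≡ true
  fit-relabel τ refl refl refl refl h = h

  distinct₁ : ∀ {a b c d : Fin N} → Distinct a b c d → Distinct b a c d
  distinct₁ (a≢b , a≢c , a≢d , b≢c , b≢d , c≢d) = ≢-sym a≢b , b≢c , b≢d , a≢c , a≢d , c≢d

  distinct₂ : ∀ {a b c d : Fin N} → Distinct a b c d → Distinct a c b d
  distinct₂ (a≢b , a≢c , a≢d , b≢c , b≢d , c≢d) = a≢c , a≢b , a≢d , ≢-sym b≢c , c≢d , b≢d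

  distinct₃ : ∀ {a b c d : Fin N} → Distinct a b c d → Distinct a b d c
  distinct₃ (a≢b , a≢c , a≢d , b≢c , b≢d , c≢d) = a≢b , a≢d , a≢c , b≢d , b≢c , ≢-sym c≢d

  distinct-exchange : ∀ {a b c d : Fin N} → Distinct a b c d → Distinct c d a b
  distinct-exchange (a≢b , a≢c , a≢d , b≢c , b≢d , c≢d) =
    c≢d , ≢-sym a≢c , ≢-sym b≢c , ≢-sym a≢d , ≢-sym b≢d , a≢b

  -- It is enough to know a cut on the 4-sets through one pair p, q of vertices.
  module Propagate (τ : Fin N → Bool) (D : Fin N → Set) {p q : Fin N} (p≢q : p ≢ q) (p∈D : D p) (q∈D : D q)
    (base : ∀ {x y : Fin N} → D x → D y → Distinct p q x y → fit S τ p q x y ≡ true) where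

    fit-p : ∀ {x y z} → D x → D y → D z → Distinct p x y z → fit S τ p x y z ≡ true
    fit-p {x} {y} {z} Dx Dy Dz dist@(p≢x , p≢y , p≢z , x≢y , x≢z , y≢z) with x ≟ q | y ≟ q | z ≟ q
    ... | yes refl | _ | _ = base Dy Dz dist
    ... | no _ | yes refl | _ = swap₂ τ (distinct₂ dist) (base Dx Dz (distinct₂ dist))
    ... | no _ | no _ | yes refl =
      swap₃ τ (distinct₃ dist) (swap₂ τ (distinct₂ (distinct₃ dist)) (base Dx Dy (distinct₂ (distinct₃ dist))))
    ... | no x≢q | no y≢q | no z≢q =
      -- In the 5-set p, q, x, y, z the three 4-sets through p and q are known, and the wanted one
      -- omits q. The same step below, with p as the omitted vertex, reaches all remaining 4-sets.
      fit-acde (p≢q , p≢x , p≢y , ≢-sym x≢q , ≢-sym y≢q , x≢y) (≢-sym p≢z , z≢q , ≢-sym x≢z , ≢-sym y≢z) τ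
        (base Dx Dy (p≢q , p≢x , p≢y , ≢-sym x≢q , ≢-sym y≢q , x≢y))
        (base Dx Dz (p≢q , p≢x , p≢z , ≢-sym x≢q , ≢-sym z≢q , x≢z))
        (base Dy Dz (p≢q , p≢y , p≢z , ≢-sym y≢q , ≢-sym z≢q , y≢z))

    fit-everywhere : ∀ {x y z w} → D x → D y → D z → D w → Distinct x y z w → fit S τ x y z w ≡ true
    fit-everywhere {x} {y} {z} {w} Dx Dy Dz Dw dist@(x≢y , x≢z , x≢w , y≢z , y≢w , z≢w)
      with x ≟ p | y ≟ p | z ≟ p | w ≟ p
    ... | yes refl | _ | _ | _ = fit-p Dy Dz Dw dist
    ... | no _ | yes refl | _ | _ = swap₁ τ (distinct₁ dist) (fit-p Dx Dz Dw (distinct₁ dist))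
    ... | no _ | no _ | yes refl | _ = at-third Dx Dy Dw dist
      where
      at-third : ∀ {x y w} → D x → D y → D w → Distinct x y p w → fit S τ x y p w ≡ true
      at-third Dx Dy Dw dist = swap₂ τ (distinct₂ dist)
        (swap₁ τ (distinct₁ (distinct₂ dist)) (fit-p Dx Dy Dw (distinct₁ (distinct₂ dist))))
    ... | no _ | no _ | no _ | yes refl = swap₃ τ (distinct₃ dist) (swap₂ τ (distinct₂ (distinct₃ dist))
        (swap₁ τ (distinct₁ (distinct₂ (distinct₃ dist)))
          (fit-p Dx Dy Dz (distinct₁ (distinct₂ (distinct₃ dist))))))
    ... | no x≢p | no y≢p | no z≢p | no w≢p =
      fit-bcde (≢-sym x≢p , ≢-sym y≢p , ≢-sym z≢p , x≢y , x≢z , y≢z) (w≢p , ≢-sym x≢w , ≢-sym y≢w , ≢-sym z≢w) τ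
        (fit-p Dx Dy Dz (≢-sym x≢p , ≢-sym y≢p , ≢-sym z≢p , x≢y , x≢z , y≢z))
        (fit-p Dx Dy Dw (≢-sym x≢p , ≢-sym y≢p , ≢-sym w≢p , x≢y , x≢w , y≢w))
        (fit-p Dx Dz Dw (≢-sym x≢p , ≢-sym z≢p , ≢-sym w≢p , x≢z , x≢w , z≢w))

  fit⇒cut : ∀ τ {x y z w} → fit S τ x y z w ≡ true → S x y z w ≡ cut (τ x) (τ y) (τ z) (τ w)
  fit⇒cut τ {x} {y} {z} {w} h =
    ==⇒≡ (∧-left {S x y z w == cut (τ x) (τ y) (τ z) (τ w)} {S x y w z == cut (τ x) (τ y) (τ w) (τ z)} h)

  -- For the empty set U the cut is constantly true, so inactivity is a special case of `fit` and
  -- spreads by `Propagate`.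
  inactive⇒fit : ∀ {x y z w} → inactive S x y z w ≡ true → fit S (λ _ → false) x y z w ≡ true
  inactive⇒fit {x} {y} {z} {w} h = ∧-intro {S x y z w == true} {S x y w z == true}
    (≡⇒== (∧-left {S x y z w} {S x y w z} h)) (≡⇒== (∧-right {S x y z w} {S x y w z} h))

  -- The star case

  module _ {a b c d : Fin N} (dist : Distinct a b c d) (active : odd S a b c d ≡ true)
           (still : ∀ (e : Fin N) → Off a b c d e → inactive S b c d e ≡ true) where

    star : DependsOnlyOn f (partner a)
    star = let a≢b , a≢c , _ , b≢c , _ = dist in
      dependsOnPartner a λ x≢a y≢a z≢a w≢a distinct →
        fit⇒cut (λ _ → false) (Propagate.fit-everywhere (λ _ → false) (_≢ a) b≢c (≢-sym a≢b) (≢-sym a≢c)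
          (λ x≢a y≢a distinct → inactive⇒fit (pair x≢a y≢a distinct)) x≢a y≢a z≢a w≢a distinct)
      where
      pair : ∀ {x y} → x ≢ a → y ≢ a → Distinct b c x y → inactive S b c x y ≡ true
      pair {x} {y} x≢a y≢a (_ , b≢x , b≢y , c≢x , c≢y , x≢y) with x ≟ d | y ≟ d
      ... | yes refl | _ = still y (y≢a , ≢-sym b≢y , ≢-sym c≢y , ≢-sym x≢y)
      ... | no _ | yes refl = trans (Bool.∧-comm (S b c x y) (S b c y x)) (still x (x≢a , ≢-sym b≢x , ≢-sym c≢x , x≢y))
      ... | no x≢d | no y≢d = inactive-pair dist
        (x≢a , ≢-sym b≢x , ≢-sym c≢x , x≢d) (y≢a , ≢-sym b≢y , ≢-sym c≢y , y≢d) x≢y active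
        (still x (x≢a , ≢-sym b≢x , ≢-sym c≢x , x≢d)) (still y (y≢a , ≢-sym b≢y , ≢-sym c≢y , y≢d))

  moves? : ∀ a b c d → (∃ λ e → Off a b c d e × inactive S b c d e ≡ false)
                     ⊎ (∀ e → Off a b c d e → inactive S b c d e ≡ true)
  moves? a b c d with any? (λ e → off? a b c d e ×-dec inactive S b c d e Bool.≟ false)
  ... | yes found = inj₁ found
  ... | no  none  = inj₂ λ e off → Bool.¬-not λ eq → none (e , off , eq)

  relabelled : ∀ {a b c d} → Distinct a b c d → odd S a b c d ≡ true →
    odd S b a c d ≡ true × odd S c d a b ≡ true × odd S d c a b ≡ true × fitAs S false false true true c d a b ≡ true
  relabelled {a} {b} {c} {d} dist o = ∧-split₄ P Q R F
    (mp {odd S a b c d} {P ∧ Q ∧ R ∧ F}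
      (relabel-holds (λ i j p q → S (v i) (v j) (v p) (v q)) (S-facts₄ dist)) o)
    where
    v = lookup (a ∷ b ∷ c ∷ d ∷ [])
    P = odd S b a c d
    Q = odd S c d a b
    R = odd S d c a b
    F = fitAs S false false true true c d a b

  -- If bcde were inactive and acde active, f would depend only on the partner of a within a, b, c,
  -- d, e, e₁, and bcde₁ would be inactive as well.
  spread : ∀ {a b c d e₁} → Distinct a b c d → odd S a b c d ≡ true →
    Off a b c d e₁ → inactive S b c d e₁ ≡ false →
    ∀ {e} → Off a b c d e → inactive S b c d e ≡ true → inactive S a c d e ≡ true
  spread {a} {b} {c} {d} {e₁} dist o off₁ moves {e} off still with e ≟ e₁
  ... | yes refl = contradiction moves (true≢false still)
  ... | no e≢e₁ = Bool.¬-not λ eq →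
    true≢false (inactive-spread dist off₁ off (≢-sym e≢e₁) o still eq) moves

  -- Two disjoint 4-sets that both move f would make it take three values.
  moves-meet : ∀ m {a b c d e h i j} → m · a ≡ b → m · c ≡ d → m · e ≡ h → m · i ≡ j →
    Distinct a b c d → Off a b c d e → Off a b c d i → e ≢ i → h ≢ i →
    S a b c d ≡ false → S e h i j ≡ false → ⊥
  moves-meet m {a} {b} {c} {d} {e} {h} {i} {j} ab cd eh ij (_ , a≢c , _ , b≢c , _) e-off i-off e≢i h≢i move₁ move₂ =
    -- The changes of disjoint switches add up: f(m) + f(m₁₂) = f(m₁) + f(m₂). If m₁ and m₂ both
    -- differ from m in value, f(m₁₂) would be 2 or -1.
    three-values ⟪ m ⟫ ⟪ m₁ ⟫ ⟪ m₂ ⟫ ⟪ m₁₂ ⟫ (balance {m} {m₂} {m₁} {m₁₂} (switch-agree s₂ s₁₂))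
      (trans (sym (S-switch s₁)) move₁) (trans (sym (S-switch s₂)) move₂)
    where
    m₁ m₂ m₁₂ : PerfectMatching N
    m₁  = join a c m
    m₂  = join e i m
    m₁₂ = join e i m₁

    s₁ : Switch a b c d m m₁
    s₁ = join-switch-at m a≢c b≢c ab cd

    s₂ : Switch e h i j m m₂
    s₂ = join-switch-at m e≢i h≢i eh ij

    kept : ∀ {x} → Off a b c d x → m₁ · x ≡ m · x
    kept {x} (x≢a , x≢b , x≢c , x≢d) = sym (Switch.rest s₁ x x≢a x≢b x≢c x≢d)

    s₁₂ : Switch e h i j m₁ m₁₂
    s₁₂ = join-switch-at m₁ e≢i h≢i (trans (kept e-off) eh) (trans (kept i-off) ij)

    three-values : ∀ p q r t → bit p + bit t ≡ bit r + bit q → (p == q) ≡ false → (p == r) ≡ false → ⊥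
    three-values true  true  _     _     _  () _
    three-values true  false true  _     _  _  ()
    three-values true  false false _     () _  _
    three-values false false _     _     _  () _
    three-values false true  false _     _  _  ()
    three-values false true  true  true  () _  _
    three-values false true  true  false () _  _

  -- The case of a cut

  module Cut {a b c d : Fin N} (dist : Distinct a b c d) (active : odd S a b c d ≡ true)
    {e₁ e₂ e₃ e₄ : Fin N}
    (off₁ : Off a b c d e₁) (moves₁ : inactive S b c d e₁ ≡ false)
    (off₂ : Off b a c d e₂) (moves₂ : inactive S a c d e₂ ≡ false)
    (off₃ : Off c d a b e₃) (moves₃ : inactive S d a b e₃ ≡ false)
    (off₄ : Off d c a b e₄) (moves₄ : inactive S c a b e₄ ≡ false) where

    private
      a≢b = proj₁ dist
      a≢c = proj₁ (proj₂ dist)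
      a≢d = proj₁ (proj₂ (proj₂ dist))
      b≢c = proj₁ (proj₂ (proj₂ (proj₂ dist)))
      b≢d = proj₁ (proj₂ (proj₂ (proj₂ (proj₂ dist))))
      c≢d = proj₂ (proj₂ (proj₂ (proj₂ (proj₂ dist))))

      off-b : ∀ {e} → Off a b c d e → Off b a c d e
      off-b (e≢a , e≢b , e≢c , e≢d) = e≢b , e≢a , e≢c , e≢d
      off-c : ∀ {e} → Off a b c d e → Off c d a b e
      off-c (e≢a , e≢b , e≢c , e≢d) = e≢c , e≢d , e≢a , e≢b
      off-d : ∀ {e} → Off a b c d e → Off d c a b e
      off-d (e≢a , e≢b , e≢c , e≢d) = e≢d , e≢c , e≢a , e≢b

      dist-b : Distinct b a c d
      dist-b = distinct₁ dist
      dist-c : Distinct c d a b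
      dist-c = distinct-exchange dist
      dist-d : Distinct d c a b
      dist-d = distinct₁ dist-c

      ⇔⇒≡ : ∀ {p q} → (p ≡ true → q ≡ true) → (q ≡ true → p ≡ true) → p ≡ q
      ⇔⇒≡ {true}  {q}     to from = sym (to refl)
      ⇔⇒≡ {false} {false} to from = refl
      ⇔⇒≡ {false} {true}  to from = from refl

      -- The witnesses e₁ and e₂ rule out that f looks like a star at a or at b, so a and b play
      -- symmetric roles towards every further vertex.
      ab-type : ∀ {e} → Off a b c d e → inactive S b c d e ≡ inactive S a c d e
      ab-type off = ⇔⇒≡ (spread dist active off₁ moves₁ off)
        (spread dist-b (proj₁ (relabelled dist active)) off₂ moves₂ (off-b off))

      cd-type : ∀ {e} → Off a b c d e → inactive S d a b e ≡ inactive S c a b e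
      cd-type off = ⇔⇒≡ (spread dist-c (proj₁ (proj₂ (relabelled dist active))) off₃ moves₃ (off-c off))
        (spread dist-d (proj₁ (proj₂ (proj₂ (relabelled dist active)))) off₄ moves₄ (off-d off))

      types : ∀ {e g} (off : Off a b c d e) (off′ : Off a b c d g) (e≢g : e ≢ g) → _
      types off off′ e≢g = types-fit dist off off′ e≢g active (ab-type off) (cd-type off) (ab-type off′) (cd-type off′)

      ==-not : ∀ {p q} → not (p == q) ≡ true → p ≡ not q
      ==-not {true}  {false} _ = refl
      ==-not {false} {true}  _ = refl

    opposite-types : ∀ {e} → Off a b c d e → inactive S b c d e ≡ not (inactive S d a b e)
    opposite-types {e} off with g , off′ , e≢g ← sixth dist off =
      ==-not (proj₁ (types off off′ e≢g))

    opaque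

      -- Membership in U; for e outside Q, the 4-set abde is inactive when it has three vertices in U.
      side : Fin N → Bool
      side x = does (x ≟ a) ∨ (does (x ≟ b) ∨ (not (does (x ≟ c)) ∧ (not (does (x ≟ d)) ∧ inactive S d a b x)))

      side-a : side a ≡ true
      side-a rewrite dec-true (a ≟ a) refl = refl

      side-b : side b ≡ true
      side-b rewrite dec-true (b ≟ b) refl = Bool.∨-zeroʳ _

      side-c : side c ≡ false
      side-c rewrite dec-false (c ≟ a) (≢-sym a≢c) | dec-false (c ≟ b) (≢-sym b≢c) | dec-true (c ≟ c) refl = refl

      side-d : side d ≡ false
      side-d rewrite dec-false (d ≟ a) (≢-sym a≢d) | dec-false (d ≟ b) (≢-sym b≢d) | dec-false (d ≟ c) (≢-sym c≢d)
                   | dec-true (d ≟ d) refl = refl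

      side-off : ∀ {e} → Off a b c d e → side e ≡ inactive S d a b e
      side-off {e} (e≢a , e≢b , e≢c , e≢d)
        rewrite dec-false (e ≟ a) e≢a | dec-false (e ≟ b) e≢b | dec-false (e ≟ c) e≢c | dec-false (e ≟ d) e≢d = refl

    fit-ae : ∀ {e} → Off a b c d e → fit S side c d a e ≡ true
    fit-ae {e} off with g , off′ , e≢g ← sixth dist off =
      fit-relabel side side-c side-d side-a (side-off off) (proj₁ (proj₂ (types off off′ e≢g)))

    fit-be : ∀ {e} → Off a b c d e → fit S side c d b e ≡ true
    fit-be {e} off with g , off′ , e≢g ← sixth dist off =
      fit-relabel side side-c side-d side-b (side-off off) (proj₁ (proj₂ (proj₂ (types off off′ e≢g))))

    fit-eg : ∀ {e g} → Off a b c d e → Off a b c d g → e ≢ g → fit S side c d e g ≡ true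
    fit-eg off off′ e≢g =
      fit-relabel side side-c side-d (side-off off) (side-off off′) (proj₂ (proj₂ (proj₂ (types off off′ e≢g))))

    base : ∀ {x y} → Distinct c d x y → fit S side c d x y ≡ true
    base {x} {y} distinct@(_ , c≢x , c≢y , d≢x , d≢y , x≢y) with x ≟ a | x ≟ b | y ≟ a | y ≟ b
    ... | yes refl | _        | _        | yes refl =
      fit-relabel side side-c side-d side-a side-b (proj₂ (proj₂ (proj₂ (relabelled dist active))))
    ... | yes refl | _        | yes refl | _        = contradiction refl x≢y
    ... | yes refl | _        | no y≢a   | no y≢b   = fit-ae (y≢a , y≢b , ≢-sym c≢y , ≢-sym d≢y)
    ... | no _     | yes refl | yes refl | _        = swap₃ side (distinct₃ distinct)
      (fit-relabel side side-c side-d side-a side-b (proj₂ (proj₂ (proj₂ (relabelled dist active)))))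
    ... | no _     | yes refl | no _     | yes refl = contradiction refl x≢y
    ... | no _     | yes refl | no y≢a   | no y≢b   = fit-be (y≢a , y≢b , ≢-sym c≢y , ≢-sym d≢y)
    ... | no x≢a   | no x≢b   | yes refl | _        =
      swap₃ side (distinct₃ distinct) (fit-ae (x≢a , x≢b , ≢-sym c≢x , ≢-sym d≢x))
    ... | no x≢a   | no x≢b   | no _     | yes refl =
      swap₃ side (distinct₃ distinct) (fit-be (x≢a , x≢b , ≢-sym c≢x , ≢-sym d≢x))
    ... | no x≢a   | no x≢b   | no y≢a   | no y≢b   =
      fit-eg (x≢a , x≢b , ≢-sym c≢x , ≢-sym d≢x) (y≢a , y≢b , ≢-sym c≢y , ≢-sym d≢y) x≢y

    side-cut : CutOf side
    side-cut distinct = fit⇒cut side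
      (Propagate.fit-everywhere side (λ _ → ⊤) c≢d tt tt (λ _ _ → base) tt tt tt tt distinct)

    -- The 4-set bcde₁ is active, so it is split evenly: c and d are outside U, hence e₁ is inside
    -- with b.
    side-e₁ : side e₁ ≡ true
    side-e₁ = trans (side-off off₁) (Bool.not-injective (trans (sym (opposite-types off₁)) moves₁))

    off₃′ : Off a b c d e₃
    off₃′ = let e₃≢c , e₃≢d , e₃≢a , e₃≢b = off₃ in e₃≢a , e₃≢b , e₃≢c , e₃≢d

    side-e₃ : side e₃ ≡ false
    side-e₃ = trans (side-off off₃′) moves₃

    -- Both ab|cd and e₁e|e₃g consist of one edge inside U and one inside its complement, so both
    -- switches change f. A single matching contains all four edges, and `moves-meet` applies.
    disjoint-contradiction : ∀ {e g} → Off a b c d e → e ≢ e₁ → side e ≡ true →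
      Off a b c d g → g ≢ e₃ → side g ≡ false → ⊥
    disjoint-contradiction {e} {g} off e≢e₁ τe off′ g≢e₃ τg =
      moves-meet m m-ab m-cd m-e₁ m-e₃ dist off₁ off₃′ e₁≢e₃ e≢e₃
        (trans (side-cut dist) flat₁)
        (trans (side-cut (≢-sym e≢e₁ , e₁≢e₃ , e₁≢g , e≢e₃ , e≢g , ≢-sym g≢e₃)) flat₂)
      where
      apart : ∀ {x y} → side x ≡ true → side y ≡ false → x ≢ y
      apart τx τy refl = true≢false τx τy

      m₀′ m′ m : PerfectMatching N
      m₀′ = through a b c d
      m′  = join e₁ e m₀′
      m   = join e₃ g m′

      e₁≢e₃ = apart side-e₁ side-e₃
      e₁≢g  = apart side-e₁ τg
      e≢e₃  = apart τe side-e₃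
      e≢g   = apart τe τg

      m-e₁ : m · e₁ ≡ e
      m-e₁ = join-keeps m′ e₁≢e₃ e₁≢g e≢e₃ e≢g (join-edge m₀′ (≢-sym e≢e₁))

      m-e₃ : m · e₃ ≡ g
      m-e₃ = join-edge m′ (≢-sym g≢e₃)

      keep : ∀ {x y} → x ≢ e₁ → x ≢ e₃ → x ≢ e → x ≢ g → y ≢ e₁ → y ≢ e₃ → y ≢ e → y ≢ g →
        m₀′ · x ≡ y → m · x ≡ y
      keep x≢e₁ x≢e₃ x≢e x≢g y≢e₁ y≢e₃ y≢e y≢g eq =
        join-keeps m′ x≢e₃ x≢g y≢e₃ y≢g (join-keeps m₀′ x≢e₁ x≢e y≢e₁ y≢e eq)

      m-ab : m · a ≡ b
      m-ab =
        let e₁≢a , e₁≢b , _ = off₁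
            e₃≢a , e₃≢b , _ = off₃′
            e≢a , e≢b , _ = off
            g≢a , g≢b , _ = off′
        in
        keep {a} {b} (≢-sym e₁≢a) (≢-sym e₃≢a) (≢-sym e≢a) (≢-sym g≢a) (≢-sym e₁≢b) (≢-sym e₃≢b) (≢-sym e≢b) (≢-sym g≢b)
          (Switch.ab (through-switch {a} {b} {c} {d} dist))

      m-cd : m · c ≡ d
      m-cd =
        let _ , _ , e₁≢c , e₁≢d = off₁
            _ , _ , e₃≢c , e₃≢d = off₃′
            _ , _ , e≢c , e≢d = off
            _ , _ , g≢c , g≢d = off′
        in
        keep {c} {d} (≢-sym e₁≢c) (≢-sym e₃≢c) (≢-sym e≢c) (≢-sym g≢c) (≢-sym e₁≢d) (≢-sym e₃≢d) (≢-sym e≢d) (≢-sym g≢d)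
          (Switch.cd (through-switch {a} {b} {c} {d} dist))

      flat₁ : cut (side a) (side b) (side c) (side d) ≡ false
      flat₁ = cut-flat side-a side-b side-c side-d

      flat₂ : cut (side e₁) (side e) (side e₃) (side g) ≡ false
      flat₂ = cut-flat side-e₁ τe side-e₃ τg

    triangle : DependsOnTriangle f
    triangle with any? (λ e → off? a b c d e ×-dec ¬? (e ≟ e₁) ×-dec side e Bool.≟ true)
                | any? (λ g → off? a b c d g ×-dec ¬? (g ≟ e₃) ×-dec side g Bool.≟ false)
    ... | yes (e , off , e≢e₁ , τe) | yes (g , off′ , g≢e₃ , τg) =
      ⊥-elim (disjoint-contradiction off e≢e₁ τe off′ g≢e₃ τg)
    ... | no none | _ = dependsOnTriangle side-cut a b e₁ side-a side-b side-e₁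
      a≢b (≢-sym (proj₁ (proj₂ off₁))) (proj₁ off₁) only
      where
      only : ∀ x → side x ≡ true → x ≡ a ⊎ x ≡ b ⊎ x ≡ e₁
      only x τx with x ≟ a | x ≟ b | x ≟ e₁
      ... | yes eq | _      | _      = inj₁ eq
      ... | no _   | yes eq | _      = inj₂ (inj₁ eq)
      ... | no _   | no _   | yes eq = inj₂ (inj₂ eq)
      ... | no x≢a | no x≢b | no x≢e₁ = contradiction
        (x , (x≢a , x≢b , (λ { refl → true≢false τx side-c }) , (λ { refl → true≢false τx side-d })) , x≢e₁ , τx) none
    -- Now the complement of U is the triangle; complementing all memberships does not affect the
    -- cut.
    ... | yes _ | no none = dependsOnTriangle
      (λ {x} {y} {z} {w} distinct → trans (side-cut distinct) (sym (cut-not (side x) (side y) (side z) (side w))))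
      c d e₃ (cong not side-c) (cong not side-d) (cong not side-e₃)
      c≢d (≢-sym (proj₁ (proj₂ off₃))) (proj₁ off₃) only
      where
      only : ∀ x → not (side x) ≡ true → x ≡ c ⊎ x ≡ d ⊎ x ≡ e₃
      only x h with x ≟ c | x ≟ d | x ≟ e₃
      ... | yes eq | _      | _      = inj₁ eq
      ... | no _   | yes eq | _      = inj₂ (inj₁ eq)
      ... | no _   | no _   | yes eq = inj₂ (inj₂ eq)
      ... | no x≢c | no x≢d | no x≢e₃ = contradiction
        (x , ((λ { refl → true≢false side-a τx }) , (λ { refl → true≢false side-b τx }) , x≢c , x≢d) , x≢e₃ , τx) none
        where
        τx : side x ≡ false
        τx = Bool.not-injective h

  classify-active : ∀ a b c d → Distinct a b c d → odd S a b c d ≡ true → DependsOnPartner f ⊎ DependsOnTriangle f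
  classify-active a b c d dist active = go (moves? a b c d) (moves? b a c d) (moves? c d a b) (moves? d c a b)
    where
    relabellings = relabelled {a} {b} {c} {d} dist active

    dist-c : Distinct c d a b
    dist-c = distinct-exchange {a} {b} {c} {d} dist

    Moves : Fin N → Fin N → Fin N → Fin N → Set
    Moves a b c d = (∃ λ e → Off a b c d e × inactive S b c d e ≡ false) ⊎ (∀ e → Off a b c d e → inactive S b c d e ≡ true)

    go : Moves a b c d → Moves b a c d → Moves c d a b → Moves d c a b → DependsOnPartner f ⊎ DependsOnTriangle f
    -- On four vertices there is no further e, so this case applies vacuously.
    go (inj₂ still) _ _ _ = inj₁ (a , star {a} {b} {c} {d} dist active still)
    go _ (inj₂ still) _ _ = inj₁ (b , star {b} {a} {c} {d} (distinct₁ {a} {b} {c} {d} dist) (proj₁ relabellings) still)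
    go _ _ (inj₂ still) _ = inj₁ (c , star {c} {d} {a} {b} dist-c (proj₁ (proj₂ relabellings)) still)
    go _ _ _ (inj₂ still) =
      inj₁ (d , star {d} {c} {a} {b} (distinct₁ {c} {d} {a} {b} dist-c) (proj₁ (proj₂ (proj₂ relabellings))) still)
    go (inj₁ (e₁ , off₁ , moves₁)) (inj₁ (e₂ , off₂ , moves₂)) (inj₁ (e₃ , off₃ , moves₃)) (inj₁ (e₄ , off₄ , moves₄)) =
      inj₂ (Cut.triangle {a} {b} {c} {d} dist active {e₁} {e₂} {e₃} {e₄} off₁ moves₁ off₂ moves₂ off₃ moves₃ off₄ moves₄)

  classify : IsConstant f ⊎ DependsOnPartner f ⊎ DependsOnTriangle f
  classify = go (any? λ a → any? λ b → any? λ c → any? λ d → distinct? a b c d ×-dec S a b c d Bool.≟ false)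
    where
    go : Dec (∃ λ a → ∃ λ b → ∃ λ c → ∃ λ d → Distinct a b c d × S a b c d ≡ false) →
      IsConstant f ⊎ DependsOnPartner f ⊎ DependsOnTriangle f
    go (no none) = inj₁ (constant λ {x} {y} {z} {w} dist → Bool.¬-not λ eq → none (x , y , z , w , dist , eq))
    go (yes (a , b , c , d , dist , eq)) = inj₂ (oriented (orient {a} {b} {c} {d} dist eq))
      where
      oriented : odd S a b c d ≡ true ⊎ odd S a c b d ≡ true → DependsOnPartner f ⊎ DependsOnTriangle f
      oriented (inj₁ active) = classify-active a b c d dist active
      oriented (inj₂ active) = classify-active a c b d (distinct₂ {a} {b} {c} {d} dist) active

-- The converse: explicit polynomials

∑-single : ∀ {n} {A : Set} (u : A → ℚ) (g : Fin n → A) p → (∀ j → j ≢ p → u (g j) ≡ 0ℚ) →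
  ∑ u (List.tabulate g) ≡ u (g p)
∑-single u g zero    h = trans (cong (u (g zero) +ℚ_) (vanish (g ∘ suc) λ j → h (suc j) λ ())) (ℚ.+-identityʳ _)
  where
  vanish : ∀ {n} (g : Fin n → _) → (∀ j → u (g j) ≡ 0ℚ) → ∑ u (List.tabulate g) ≡ 0ℚ
  vanish {zero}  g h = refl
  vanish {suc n} g h = trans (cong₂ _+ℚ_ (h zero) (vanish (g ∘ suc) (h ∘ suc))) (ℚ.+-identityˡ 0ℚ)
∑-single u g (suc p) h = trans (cong₂ _+ℚ_ (h zero λ ()) (∑-single u (g ∘ suc) p λ j j≢p → h (suc j) (j≢p ∘ suc-injective)))
  (ℚ.+-identityˡ _)

module _ {N : ℕ} where

  edge-between : ∀ i j → i ≢ j → ∃ λ e → ∀ m → x[ e ] m ≡ ⟦ has {N} m i j ⟧ᵇ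
  edge-between i j i≢j with <-cmp i j
  ... | tri< i<j _ _ = edge i<j , λ _ → refl
  ... | tri≈ _ i≡j _ = contradiction i≡j i≢j
  ... | tri> _ _ j<i = edge j<i , λ m → cong ⟦_⟧ᵇ (symmetric m j i)

  has-edge : ∀ (m : PerfectMatching N) {i j} → m · i ≡ j → has m i j ≡ true
  has-edge m {i} refl = has-partner m i

  has-none : ∀ (m : PerfectMatching N) {i j} → m · i ≢ j → has m i j ≡ false
  has-none m neq = Bool.¬-not (neq ∘ partner-unique m)

  degree-from-values : ∀ (f : BooleanFunction N) p → HasDegree≤ 1 p →
    (∀ m k → seq (eval p m) k ≡ ⟦ Func.to f m ⟧ℚ) → DegreeAtMost 1 f
  degree-from-values f p d eq = p , d , λ m →
    ≗⇒≈ᵣ {eval p m} {⟦ Func.to f m ⟧ᵇ} λ k → trans (eq m k) (sym (seq-bit (Func.to f m) k))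

  seq-term : ∀ c {i j} (i≢j : i ≢ j) p m k →
    seq (eval ((c , proj₁ (edge-between i j i≢j) ∷ []) ∷ p) m) k ≡ seq c k *ℚ ⟦ has m i j ⟧ℚ +ℚ seq (eval p m) k
  seq-term c {i} {j} i≢j p m k = cong (λ q → seq c k *ℚ q +ℚ seq (eval p m) k)
    (trans (ℚ.*-identityʳ _) (trans (cong (λ x → seq x k) (proj₂ (edge-between i j i≢j) m)) (seq-bit (has m i j) k)))

  constant⇒degree : ∀ (f : BooleanFunction N) → IsConstant f → DegreeAtMost 1 f
  constant⇒degree f (b , f≡b) = degree-from-values f ((⟦ b ⟧ᵇ , []) ∷ []) (z≤n ∷ [])
    λ m k → trans (ℚ.+-identityʳ _) (trans (ℚ.*-identityʳ _) (trans (seq-bit b k) (cong ⟦_⟧ℚ (sym (f≡b m)))))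

  module _ (i : Fin N) (b : Fin N → Bool) where

    partnerPolynomial : List (Fin N) → Polynomial N
    partnerPolynomial []       = []
    partnerPolynomial (j ∷ js) with i ≟ j
    ... | yes _  = partnerPolynomial js
    ... | no i≢j = (⟦ b j ⟧ᵇ , proj₁ (edge-between i j i≢j) ∷ []) ∷ partnerPolynomial js

    partnerPolynomial-degree : ∀ js → HasDegree≤ 1 (partnerPolynomial js)
    partnerPolynomial-degree []       = []
    partnerPolynomial-degree (j ∷ js) with i ≟ j
    ... | yes _ = partnerPolynomial-degree js
    ... | no _  = s≤s z≤n ∷ partnerPolynomial-degree js

    seq-partnerPolynomial : ∀ m k js →
      seq (eval (partnerPolynomial js) m) k ≡ ∑ (λ j → ⟦ b j ⟧ℚ *ℚ ⟦ has m i j ⟧ℚ) js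
    seq-partnerPolynomial m k []       = refl
    seq-partnerPolynomial m k (j ∷ js) with i ≟ j
    ... | yes refl rewrite irreflexive m i = trans (seq-partnerPolynomial m k js)
      (sym (trans (cong (_+ℚ ∑ (λ j → ⟦ b j ⟧ℚ *ℚ ⟦ has m i j ⟧ℚ) js) (ℚ.*-zeroʳ ⟦ b i ⟧ℚ)) (ℚ.+-identityˡ _)))
    ... | no i≢j = trans (seq-term ⟦ b j ⟧ᵇ i≢j (partnerPolynomial js) m k)
      (cong₂ (λ p q → p *ℚ ⟦ has m i j ⟧ℚ +ℚ q) (seq-bit (b j) k) (seq-partnerPolynomial m k js))

    partnerPolynomial-value : ∀ m k → seq (eval (partnerPolynomial (allFin N)) m) k ≡ ⟦ b (m · i) ⟧ℚ
    partnerPolynomial-value m k = trans (seq-partnerPolynomial m k (allFin N))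
      (trans (∑-single (λ j → ⟦ b j ⟧ℚ *ℚ ⟦ has m i j ⟧ℚ) (λ j → j) (m · i)
               λ j j≢mi → trans (cong (λ h → ⟦ b j ⟧ℚ *ℚ ⟦ h ⟧ℚ) (has-none m (≢-sym j≢mi))) (ℚ.*-zeroʳ ⟦ b j ⟧ℚ))
             (trans (cong (λ h → ⟦ b (m · i) ⟧ℚ *ℚ ⟦ h ⟧ℚ) (has-partner m i)) (ℚ.*-identityʳ _)))

  module _ (m₀ : PerfectMatching N) (f : BooleanFunction N) where

    partner⇒degree : DependsOnPartner f → DegreeAtMost 1 f
    partner⇒degree (i , depends) = degree-from-values f (partnerPolynomial i b (allFin N))
      (partnerPolynomial-degree i b (allFin N)) λ m k → trans (partnerPolynomial-value i b m k)
        (cong ⟦_⟧ℚ (depends (join i (m · i) m₀) m (join-edge m₀ (≢-sym (·-irreflexive m i)))))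
      where
      b : Fin N → Bool
      -- For j distinct from i this is a sample matching in which i has partner j. For j = i the
      -- polynomial has no term.
      b j = Func.to f (join i j m₀)

    module _ {i j k : Fin N} (i≢j : i ≢ j) (j≢k : j ≢ k) (k≢i : k ≢ i) where

      private
        m₁ : PerfectMatching N
        m₁ = join i j m₀

        m₁-ij : m₁ · i ≡ j
        m₁-ij = join-edge m₀ i≢j

        l : Fin N
        l = m₁ · k

        l≢i : l ≢ i
        l≢i eq = j≢k (trans (sym m₁-ij) (·-swap m₁ eq))

      -- A vertex x besides i, j, k, l allows a switch of ij to ix that keeps kl, and the result
      -- misses the triangle. On four vertices i and j would otherwise both be matched to l.
      missesTriangle? : (∃ λ m → meetsTriangle i j k m ≡ false) ⊎ (∀ m → meetsTriangle i j k m ≡ true)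
      missesTriangle? with any? (λ x → ¬? (x ≟ i) ×-dec ¬? (x ≟ j) ×-dec ¬? (x ≟ k) ×-dec ¬? (x ≟ l))
      ... | yes (x , x≢i , x≢j , x≢k , x≢l) = inj₁ (m₂ , misses)
        where
        m₂ : PerfectMatching N
        m₂ = join i x m₁
        s : Switch i j x (m₁ · x) m₁ m₂
        s = subst (λ z → Switch i z x (m₁ · x) m₁ m₂) m₁-ij
              (join-switch m₁ (≢-sym x≢i) λ eq → x≢j (trans (sym eq) m₁-ij))
        misses : meetsTriangle i j k m₂ ≡ false
        misses rewrite has-none m₂ {i} {j} (λ eq → x≢j (trans (sym (Switch.ac s)) eq))
                     | has-none m₂ {j} {k} (λ eq → x≢l (sym (·-swap m₁ (trans (sym (Switch.bd s)) eq))))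
                     | has-none m₂ {k} {i} (λ eq → l≢i (trans
                         (Switch.rest s k k≢i (≢-sym j≢k) (≢-sym x≢k) (λ k≡ → x≢l (sym (·-swap m₁ (sym k≡))))) eq)) = refl
      ... | no none = inj₂ meets
        where
        only : ∀ x → x ≢ i → x ≢ j → x ≢ k → x ≡ l
        only x x≢i x≢j x≢k with x ≟ l
        ... | yes eq = eq
        ... | no neq = contradiction (x , x≢i , x≢j , x≢k , neq) none
        meets : ∀ m → meetsTriangle i j k m ≡ true
        meets m with m · i ≟ j | m · i ≟ k | m · j ≟ k
        ... | yes ij | _ | _ rewrite has-edge m ij = refl
        ... | no _ | yes ik | _ rewrite has-edge m (·-swap m ik) =
          trans (cong (has m i j ∨_) (Bool.∨-zeroʳ (has m j k))) (Bool.∨-zeroʳ (has m i j))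
        ... | no _ | no _ | yes jk rewrite has-edge m jk = Bool.∨-zeroʳ (has m i j)
        ... | no mi≢j | no mi≢k | no mj≢k = contradiction
          (·-injective m (trans (only (m · i) (·-irreflexive m i) mi≢j mi≢k)
            (sym (only (m · j) (mi≢j ∘ ·-swap m) (·-irreflexive m j) mj≢k)))) i≢j

    triangle⇒degree : DependsOnTriangle f → DegreeAtMost 1 f
    triangle⇒degree (i , j , k , i≢j , j≢k , k≢i , depends) = degree-from-values f
      ((⟦ c₀ ⟧ᵇ , []) ∷ (δ , proj₁ (edge-between i j i≢j) ∷ []) ∷ tjk ∷ tki ∷ [])
      (z≤n ∷ s≤s z≤n ∷ s≤s z≤n ∷ s≤s z≤n ∷ [])
      λ m t → trans
        (cong (λ q → seq ⟦ c₀ ⟧ᵇ t *ℚ 1ℚ +ℚ q)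
          (trans (seq-term δ i≢j (tjk ∷ tki ∷ []) m t) (cong (seq δ t *ℚ ⟦ has m i j ⟧ℚ +ℚ_)
            (trans (seq-term δ j≢k (tki ∷ []) m t) (cong (seq δ t *ℚ ⟦ has m j k ⟧ℚ +ℚ_)
              (seq-term δ k≢i [] m t))))))
        (trans (arithmetic c₀ c₁ (has m i j) (has m j k) (has m k i) t
            -- Two edges of a triangle share a vertex, so a matching contains at most one, and the
            -- three indicators sum to the indicator of meeting the triangle.
            (λ ij jk → k≢i (trans (sym (partner-unique m jk)) (·-swap m (partner-unique m ij))))
            (λ jk ki → i≢j (trans (sym (partner-unique m ki)) (·-swap m (partner-unique m jk))))
            (λ ki ij → j≢k (trans (sym (partner-unique m ij)) (·-swap m (partner-unique m ki)))))
          (cong ⟦_⟧ℚ (value m)))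
      where
      m₁ : PerfectMatching N
      m₁ = join i j m₀

      c₁ c₀ : Bool
      c₁ = Func.to f m₁
      c₀ with missesTriangle? i≢j j≢k k≢i
      ... | inj₁ (m , _) = Func.to f m
      -- A placeholder: in this case no matching misses the triangle, so it never has to equal a
      -- value of f.
      ... | inj₂ _       = true

      δ : ℝ
      δ = ⟦ c₁ ⟧ᵇ +ᵣ -ᵣ ⟦ c₀ ⟧ᵇ

      tjk tki : Term N
      tjk = δ , proj₁ (edge-between j k j≢k) ∷ []
      tki = δ , proj₁ (edge-between k i k≢i) ∷ []

      m₁-meets : meetsTriangle i j k m₁ ≡ true
      m₁-meets rewrite has-edge m₁ (join-edge m₀ i≢j) = refl

      value : ∀ m → (if meetsTriangle i j k m then c₁ else c₀) ≡ Func.to f m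
      value m with meetsTriangle i j k m in eq
      ... | true = depends m₁ m (trans m₁-meets (sym eq))
      ... | false with missesTriangle? i≢j j≢k k≢i
      ...   | inj₁ (m₂ , misses) = depends m₂ m (trans misses (sym eq))
      ...   | inj₂ meets         = contradiction (trans (sym (meets m)) eq) λ ()

      arithmetic : ∀ c₀ c₁ p q r t → (p ≡ true → q ≡ true → ⊥) → (q ≡ true → r ≡ true → ⊥) → (r ≡ true → p ≡ true → ⊥) →
        let d = seq (⟦ c₁ ⟧ᵇ +ᵣ -ᵣ ⟦ c₀ ⟧ᵇ) t in
        seq ⟦ c₀ ⟧ᵇ t *ℚ 1ℚ +ℚ (d *ℚ ⟦ p ⟧ℚ +ℚ (d *ℚ ⟦ q ⟧ℚ +ℚ (d *ℚ ⟦ r ⟧ℚ +ℚ 0ℚ))) ≡ ⟦ if p ∨ q ∨ r then c₁ else c₀ ⟧ℚ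
      arithmetic _     _     true  true  _     t pq _ _ = ⊥-elim (pq refl refl)
      arithmetic _     _     true  false true  t _ _ rp = ⊥-elim (rp refl refl)
      arithmetic _     _     false true  true  t _ qr _ = ⊥-elim (qr refl refl)
      arithmetic true  true  true  false false t _ _ _ = refl
      arithmetic true  false true  false false t _ _ _ = refl
      arithmetic false true  true  false false t _ _ _ = refl
      arithmetic false false true  false false t _ _ _ = refl
      arithmetic true  true  false true  false t _ _ _ = refl
      arithmetic true  false false true  false t _ _ _ = refl
      arithmetic false true  false true  false t _ _ _ = refl
      arithmetic false false false true  false t _ _ _ = refl
      arithmetic true  true  false false true  t _ _ _ = refl
      arithmetic true  false false false true  t _ _ _ = refl
      arithmetic false true  false false true  t _ _ _ = refl
      arithmetic false false false false true  t _ _ _ = refl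
      arithmetic true  true  false false false t _ _ _ = refl
      arithmetic true  false false false false t _ _ _ = refl
      arithmetic false true  false false false t _ _ _ = refl
      arithmetic false false false false false t _ _ _ = refl

theorem1p4 : (n : ℕ) (f : BooleanFunction (2 * n)) →
    DegreeAtMost 1 f ⇔ (IsConstant f ⊎ DependsOnPartner f ⊎ DependsOnTriangle f)
theorem1p4 n f = mk⇔ (Global.classify m₀ f) from
  where
  m₀ = standardMatching n
  from : IsConstant f ⊎ DependsOnPartner f ⊎ DependsOnTriangle f → DegreeAtMost 1 f
  from (inj₁ c)        = constant⇒degree f c
  from (inj₂ (inj₁ p)) = partner⇒degree m₀ f p
  from (inj₂ (inj₂ t)) = triangle⇒degree m₀ f t
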